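{- Let $m,n\ge 3$ be integers. Then $$ {\rm rn}(P_m\Box K_{1,n})=\begin{cases}\frac12\left[m^2(n+1)+2m+n-1\right], & \text{if } m \text{ is odd},\\[2pt] \frac12\left[m^2(n+1)+2(m-1)\right], & \text{if } m \text{ is even}.\end{cases} $$
   Context: $P_m$ is the path on $m$ vertices, $K_{1,n}$ is the star with one center adjacent to $n$ leaves, and $\Box$ denotes the Cartesian product of graphs. A radio labeling of a connected graph $G$ is a map $f:V(G)\to\mathbb{Z}_{\ge 0}$ with $|f(u)-f(v)|\geq {\rm diam}(G)+1-d(u,v)$ for all distinct vertices $u,v$, where $d$ is the graph distance; its span is $\max f-\min f$, and the radio number ${\rm rn}(G)$ is the minimum span of a radio labeling of $G$. -}

module Defs where

open import Data.Nat using (ℕ; zero; suc; _+_; _*_; _∸_; _≤_; ∣_-_∣)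
open import Data.Fin using (Fin; toℕ)
import Data.Fin as F
open import Data.Product using (Σ; _×_; _,_; ∃)
open import Data.Sum using (_⊎_)
open import Relation.Binary.PropositionalEquality using (_≡_; _≢_)

record Graph : Set₁ where
  field
    V   : Set
    Adj : V → V → Set
open Graph public

data Walk (G : Graph) : V G → V G → ℕ → Set where
  here : ∀ {u} → Walk G u u 0
  step : ∀ {u w v k} → Adj G u w → Walk G w v k → Walk G u v (suc k)

Dist : (G : Graph) → V G → V G → ℕ → Set
Dist G u v k = Walk G u v k × (∀ j → Walk G u v j → k ≤ j)

Diam : Graph → ℕ → Set
Diam G D = (Σ (V G) λ u → Σ (V G) λ v → Dist G u v D)
         × (∀ u v k → Dist G u v k → k ≤ D)

-- radio labeling w.r.t. diameter D:  |f u - f v| ≥ D + 1 - d(u,v)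
-- (equivalently, since everything is in ℕ:  D + 1 ≤ |f u - f v| + d(u,v)).
IsRadioLabeling : (G : Graph) → ℕ → (V G → ℕ) → Set
IsRadioLabeling G D f =
  ∀ u v → u ≢ v → ∀ k → Dist G u v k → D + 1 ∸ k ≤ ∣ f u - f v ∣

Span : (G : Graph) → (V G → ℕ) → ℕ → Set
Span G f s = Σ (V G) λ a → Σ (V G) λ b →
  (∀ w → f a ≤ f w × f w ≤ f b) × (f b ∸ f a ≡ s)

IsRadioNumber : Graph → ℕ → Set
IsRadioNumber G r = Σ ℕ λ D → Diam G D ×
  ((Σ (V G → ℕ) λ f → IsRadioLabeling G D f × Span G f r)
   × (∀ f s → IsRadioLabeling G D f → Span G f s → r ≤ s))

PathAdj : ∀ {m} → Fin m → Fin m → Set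
PathAdj i j = (suc (toℕ i) ≡ toℕ j) ⊎ (suc (toℕ j) ≡ toℕ i)

StarAdj : ∀ {n} → Fin (suc n) → Fin (suc n) → Set
StarAdj {n} a b = (a ≡ F.zero × b ≢ F.zero) ⊎ (b ≡ F.zero × a ≢ F.zero)

_□_ : Graph → Graph → Graph
G □ H = record
  { V   = V G × V H
  ; Adj = λ { (g , h) (g' , h') →
              (Adj G g g' × h ≡ h') ⊎ (g ≡ g' × Adj H h h') } }

P : ℕ → Graph
P m = record { V = Fin m ; Adj = PathAdj }

K1 : ℕ → Graph
K1 n = record { V = Fin (suc n) ; Adj = StarAdj }

{-# OPTIONS --safe #-}
module Submission where

-- Lower bound: sort the vertices by label.  Since 2 d(u,v) ≤ w(u) + w(v) for the weight
-- w(y,a) = |2y + 1 - m| + 2[a is a leaf], telescoping D + 1 - d over consecutive vertices bounds the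
-- span from below in terms of the total weight; the two extreme vertices u, v contribute
-- w(u) + w(v) ≥ 2 d(u,v) ≥ 2.
-- Upper bound: equality forces consecutive vertices onto opposite sides of the middle of the path and
-- onto different leaves.  Row x is paired with row x + ⌊m/2⌋, and the pairs are visited in rounds of
-- increasing x, each row meeting one new leaf per round; most of the vertices over the star centre
-- are visited in one descending round near the start.  Vertices two or more pairs apart are then
-- automatically far enough from each other, so only neighbouring pairs have to be inspected.

open import Defs
open import Data.Empty using (⊥-elim)
open import Data.Fin as Fin using (Fin; toℕ; fromℕ<)
open import Data.Fin.Properties as Fin using (toℕ-fromℕ<; toℕ-injective; toℕ<n; toℕ≤pred[n])
open import Data.List using (List; []; _∷_; _++_; map; length; allFin; tabulate; applyUpTo; cartesianProduct)
open import Data.List.Properties using (map-tabulate; length-map; length-tabulate; map-++; map-∘; length-++)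
open import Data.List.Membership.Propositional using (_∈_)
open import Data.List.Relation.Unary.Any using (here; there)
open import Data.List.Relation.Unary.All as All using (All)
open import Data.List.Relation.Unary.AllPairs using ([]; _∷_)
open import Data.List.Relation.Unary.Linked using (Linked; []; [-]; _∷_)
open import Data.List.Relation.Unary.Unique.Propositional using (Unique)
open import Data.List.Relation.Unary.Unique.Propositional.Properties using (allFin⁺; cartesianProduct⁺)
open import Data.List.Relation.Binary.Permutation.Propositional using (↭-sym; ↭⇒↭ₛ)
open import Data.List.Relation.Binary.Permutation.Propositional.Properties using (map⁺; ↭-length)
import Data.List.Relation.Binary.Permutation.Setoid.Properties as SetoidPermutation
import Data.List.Sort as Sort
open import Data.Nat using (ℕ; zero; suc; _+_; _*_; _∸_; _≤_; _<_; z≤n; s≤s; s≤s⁻¹; ∣_-_∣; _≟_; _≤?_; _<?_; _%_; _/_; ⌊_/2⌋)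
open import Data.Nat.DivMod using (m≡m%n+[m/n]*n)
open import Data.Nat.ListAction using (sum)
open import Data.Nat.ListAction.Properties using (sum-++; sum-↭)
open import Data.Nat.Properties
open import Data.Nat.Tactic.RingSolver using (solve-∀)
open import Data.Product using (∃; _×_; _,_; proj₁; proj₂)
open import Data.Sum as Sum using (_⊎_; inj₁; inj₂)
open import Data.Vec using (Vec; []; _∷_; lookup)
open import Function using (_∘_)
open import Relation.Nullary using (¬_; yes; no)
open import Relation.Nullary.Decidable using (toWitness; _×-dec_; _⊎-dec_)
open import Relation.Binary using (tri<; tri≈; tri>)
import Relation.Binary.Construct.On as On
open import Relation.Binary.PropositionalEquality

-- The weight is twice the distance to the centre of the product, which for even m lies halfway
-- between two rows; the bound on 2 d is the triangle inequality through that centre. The span meets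
-- the lower bound exactly if every step has a shortest path through the centre, its labels differ
-- by m + 2 - d, and the two extreme vertices are adjacent with total weight 2. Consecutive vertices
-- are easily arranged in this way. The obstacle is vertices visited in quick succession over the
-- same leaf, where the star contributes no distance. The leaves are therefore shifted cyclically
-- between the parts of the path: a leaf that returns in a neighbouring round does so in a higher
-- row or after enough time, and n ≥ 3 keeps the shifts distinct. For odd m the middle row has no
-- partner and joins rows 0 and 2k in a triple. With m = 3 the triple is all there is, and a larger
-- shift is needed, which collides modulo n for n = 3.

-- A ≤ B from P ≤ Q by the ring identity B - A = (Q - P) + C, stated without subtraction.
linear : ∀ {P Q A B} → P ≤ Q → ∀ C → A + Q + C ≡ B + P → A ≤ B
linear {P} {Q} {A} {B} h C eq =
  +-cancelʳ-≤ P A B (≤-trans (+-monoʳ-≤ A h) (≤-trans (m≤m+n (A + Q) C) (≤-reflexive eq)))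

-- Distances in the star, the path and their product

starDist : ℕ → ℕ → ℕ
starDist zero    zero    = 0
starDist zero    (suc b) = 1
starDist (suc a) zero    = 1
starDist (suc a) (suc b) with a ≟ b
... | yes _ = 0
... | no _  = 2

starDist-refl : ∀ a → starDist a a ≡ 0
starDist-refl zero = refl
starDist-refl (suc a) with a ≟ a
... | yes _ = refl
... | no ne = ⊥-elim (ne refl)

starDist-leaves : ∀ {a b} → a ≢ b → starDist (suc a) (suc b) ≡ 2
starDist-leaves {a} {b} a≢b with a ≟ b
... | yes eq = ⊥-elim (a≢b eq)
... | no _   = refl

starDist-sym : ∀ a b → starDist a b ≡ starDist b a
starDist-sym zero    zero    = refl
starDist-sym zero    (suc b) = refl
starDist-sym (suc a) zero    = refl
starDist-sym (suc a) (suc b) with a ≟ b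
... | yes refl = sym (starDist-refl (suc a))
... | no ne    = sym (starDist-leaves (ne ∘ sym))

starDist≤2 : ∀ a b → starDist a b ≤ 2
starDist≤2 zero    zero    = z≤n
starDist≤2 zero    (suc b) = s≤s z≤n
starDist≤2 (suc a) zero    = s≤s z≤n
starDist≤2 (suc a) (suc b) with a ≟ b
... | yes _ = z≤n
... | no _  = ≤-refl

starDist≡0⇒≡ : ∀ a b → starDist a b ≡ 0 → a ≡ b
starDist≡0⇒≡ zero    zero    eq = refl
starDist≡0⇒≡ (suc a) (suc b) eq with a ≟ b
... | yes refl = refl

∣m-1+m∣≡1 : ∀ m → ∣ m - suc m ∣ ≡ 1
∣m-1+m∣≡1 zero    = refl
∣m-1+m∣≡1 (suc m) = ∣m-1+m∣≡1 m

PathAdj-∣-∣ : ∀ {m} {i j : Fin m} → PathAdj i j → ∣ toℕ i - toℕ j ∣ ≡ 1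
PathAdj-∣-∣ {i = i} (inj₁ eq) rewrite sym eq = ∣m-1+m∣≡1 (toℕ i)
PathAdj-∣-∣ {i = i} {j} (inj₂ eq) rewrite sym eq = trans (∣-∣-comm (suc (toℕ j)) (toℕ j)) (∣m-1+m∣≡1 (toℕ j))

StarAdj-starDist : ∀ {n} {a b : Fin (suc n)} → StarAdj a b → ∀ c → starDist (toℕ a) c ≤ suc (starDist (toℕ b) c)
StarAdj-starDist (inj₁ (refl , _)) zero    = z≤n
StarAdj-starDist (inj₁ (refl , _)) (suc c) = s≤s z≤n
StarAdj-starDist {a = a} (inj₂ (refl , _)) zero with toℕ a
... | zero  = z≤n
... | suc _ = ≤-refl
StarAdj-starDist {a = a} (inj₂ (refl , _)) (suc c) = starDist≤2 (toℕ a) (suc c)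

_∙_ : ∀ {G u v w j k} → Walk G u v j → Walk G v w k → Walk G u w (j + k)
here     ∙ q = q
step e p ∙ q = step e (p ∙ q)

path-up : ∀ {m} d (i j : Fin m) → toℕ i + d ≡ toℕ j → Walk (P m) i j d
path-up zero i j eq with refl ← toℕ-injective (trans (sym (+-identityʳ (toℕ i))) eq) = here
path-up {m} (suc d) i j eq = step (inj₁ (sym next)) (path-up d (fromℕ< lt) j
    (trans (cong (_+ d) next) (trans (sym (+-suc (toℕ i) d)) eq)))
  where
  lt : suc (toℕ i) < m
  lt = ≤-<-trans (≤-trans (s≤s (m≤m+n (toℕ i) d)) (≤-reflexive (trans (sym (+-suc (toℕ i) d)) eq))) (toℕ<n j)
  next : toℕ (fromℕ< lt) ≡ suc (toℕ i)
  next = toℕ-fromℕ< lt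

path-reverse : ∀ {m} {i j : Fin m} {k} → Walk (P m) i j k → Walk (P m) j i k
path-reverse here = here
path-reverse {k = suc k} (step (inj₁ e) p) = subst (Walk _ _ _) (+-comm k 1) (path-reverse p ∙ step (inj₂ e) here)
path-reverse {k = suc k} (step (inj₂ e) p) = subst (Walk _ _ _) (+-comm k 1) (path-reverse p ∙ step (inj₁ e) here)

path-walk : ∀ {m} (i j : Fin m) → Walk (P m) i j ∣ toℕ i - toℕ j ∣
path-walk i j with ≤-total (toℕ i) (toℕ j)
... | inj₁ le = path-up _ i j (trans (cong (toℕ i +_) (m≤n⇒∣m-n∣≡n∸m le)) (m+[n∸m]≡n le))
... | inj₂ ge = path-reverse (path-up _ j i (trans (cong (toℕ j +_) (m≤n⇒∣n-m∣≡n∸m ge)) (m+[n∸m]≡n ge)))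

star-walk : ∀ {n} (a b : Fin (suc n)) → Walk (K1 n) a b (starDist (toℕ a) (toℕ b))
star-walk Fin.zero    Fin.zero    = here
star-walk Fin.zero    (Fin.suc b) = step (inj₁ (refl , λ ())) here
star-walk (Fin.suc a) Fin.zero    = step (inj₂ (refl , λ ())) here
star-walk (Fin.suc a) (Fin.suc b) with toℕ a ≟ toℕ b
... | yes eq with refl ← toℕ-injective eq = here
... | no _   = step (inj₂ (refl , λ ())) (step (inj₁ (refl , λ ())) here)

□-walkˡ : ∀ {G H i j k} a → Walk G i j k → Walk (G □ H) (i , a) (j , a) k
□-walkˡ a here       = here
□-walkˡ a (step e p) = step (inj₁ (e , refl)) (□-walkˡ a p)

□-walkʳ : ∀ {G H a b k} i → Walk H a b k → Walk (G □ H) (i , a) (i , b) k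
□-walkʳ i here       = here
□-walkʳ i (step e p) = step (inj₂ (refl , e)) (□-walkʳ i p)

module Product (m n : ℕ) where

  G : Graph
  G = P m □ K1 n

  dist : V G → V G → ℕ
  dist (i , a) (j , b) = ∣ toℕ i - toℕ j ∣ + starDist (toℕ a) (toℕ b)

  dist-refl : ∀ u → dist u u ≡ 0
  dist-refl (i , a) = cong₂ _+_ (∣n-n∣≡0 (toℕ i)) (starDist-refl (toℕ a))

  dist≡0⇒≡ : ∀ u v → dist u v ≡ 0 → u ≡ v
  dist≡0⇒≡ (i , a) (j , b) eq = cong₂ _,_
    (toℕ-injective (∣m-n∣≡0⇒m≡n (m+n≡0⇒m≡0 _ eq)))
    (toℕ-injective (starDist≡0⇒≡ _ _ (m+n≡0⇒n≡0 ∣ toℕ i - toℕ j ∣ eq)))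

  -- One edge changes the distance to a fixed target by at most one; iterated along a walk, this
  -- makes `dist` a lower bound for its length.
  dist-adj : ∀ {u w} → Adj G u w → ∀ v → dist u v ≤ suc (dist w v)
  dist-adj {i , a} {j , .a} (inj₁ (e , refl)) (l , c) = +-monoˡ-≤ (starDist (toℕ a) (toℕ c))
    (subst (λ d → ∣ toℕ i - toℕ l ∣ ≤ d + ∣ toℕ j - toℕ l ∣) (PathAdj-∣-∣ e)
      (∣-∣-triangle (toℕ i) (toℕ j) (toℕ l)))
  dist-adj {i , a} {.i , b} (inj₂ (refl , e)) (l , c) =
    ≤-trans (+-monoʳ-≤ ∣ toℕ i - toℕ l ∣ (StarAdj-starDist e (toℕ c)))
      (≤-reflexive (+-suc ∣ toℕ i - toℕ l ∣ _))

  dist≤walk : ∀ {u v k} → Walk G u v k → dist u v ≤ k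
  dist≤walk {u} here = ≤-reflexive (dist-refl u)
  dist≤walk {v = v} (step e p) = ≤-trans (dist-adj e v) (s≤s (dist≤walk p))

  dist-walk : ∀ u v → Walk G u v (dist u v)
  dist-walk (i , a) (j , b) = □-walkˡ a (path-walk i j) ∙ □-walkʳ j (star-walk a b)

  Dist-dist : ∀ u v → Dist G u v (dist u v)
  Dist-dist u v = dist-walk u v , λ _ → dist≤walk

  Dist⇒≡dist : ∀ {u v k} → Dist G u v k → k ≡ dist u v
  Dist⇒≡dist {u} {v} (p , least) = ≤-antisym (least _ (dist-walk u v)) (dist≤walk p)

-- Attained between the two ends of the path over different leaves, which is why the star is given
-- as `2 + n`.
diameter : ∀ m n → Diam (P (suc m) □ K1 (2 + n)) (suc m + 1)
diameter m n = (bottom , top , subst (Dist G bottom top) extremal (Dist-dist bottom top)) , bound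
  where
  open Product (suc m) (2 + n)
  bottom top : V G
  bottom = Fin.zero , Fin.suc Fin.zero
  top    = Fin.fromℕ m , Fin.suc (Fin.suc Fin.zero)
  extremal : dist bottom top ≡ suc m + 1
  extremal = trans (cong (_+ 2) (Fin.toℕ-fromℕ m)) (+-suc m 1)
  bound : ∀ u v k → Dist G u v k → k ≤ suc m + 1
  bound (i , a) (j , b) k d = subst (_≤ suc m + 1) (sym (Dist⇒≡dist d))
    (≤-trans (+-mono-≤ (≤-trans (∣m-n∣≤m⊔n (toℕ i) (toℕ j)) (⊔-lub (toℕ≤pred[n] i) (toℕ≤pred[n] j)))
                       (starDist≤2 (toℕ a) (toℕ b)))
             (≤-reflexive (+-suc m 1)))

-- Lower bound on the span

-- Every inner vertex takes part in two links and each end in one, so the links add up to twice the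
-- total weight less the two end weights.
chain : ∀ {A : Set} (f w : A → ℕ) C x xs →
  Linked (λ u v → 2 * f u + 2 * C ≤ 2 * f v + (w u + w v)) (x ∷ xs) →
  ∃ λ y → y ∈ (x ∷ xs) × 2 * f x + 2 * C * length xs + (w x + w y) ≤ 2 * f y + 2 * sum (map w (x ∷ xs))
chain f w C x [] [-] = x , here refl , ≤-reflexive (single (f x) (w x) C)
  where
  single : ∀ a b c → 2 * a + 2 * c * 0 + (b + b) ≡ 2 * a + 2 * (b + 0)
  single = solve-∀
chain f w C x (x′ ∷ xs) (link ∷ links) with chain f w C x′ xs links
... | y , y∈ , le = y , there y∈ , linear (+-mono-≤ link le) 0
  (eq (f x) (f x′) (f y) (w x) (w x′) (w y) C (length xs) (sum (map w xs)))
  where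
  eq : ∀ a a′ b p p′ q c l s →
    2 * a + 2 * c * suc l + (p + q) + (2 * a′ + (p + p′) + (2 * b + 2 * (p′ + s))) + 0 ≡
    2 * b + 2 * (p + (p′ + s)) + (2 * a + 2 * c + (2 * a′ + 2 * c * l + (p′ + q)))
  eq = solve-∀

length-cartesianProduct : ∀ {A B : Set} (xs : List A) (ys : List B) →
  length (cartesianProduct xs ys) ≡ length xs * length ys
length-cartesianProduct []       ys = refl
length-cartesianProduct (x ∷ xs) ys = trans (length-++ (map (x ,_) ys))
  (cong₂ _+_ (length-map (x ,_) ys) (length-cartesianProduct xs ys))

sum-cartesianProduct : ∀ {A B : Set} (g : A → ℕ) (h : B → ℕ) xs ys →
  sum (map (λ { (x , y) → g x + h y }) (cartesianProduct xs ys)) ≡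
  length ys * sum (map g xs) + length xs * sum (map h ys)
sum-cartesianProduct g h [] ys = sym (trans (+-identityʳ _) (*-zeroʳ (length ys)))
sum-cartesianProduct g h (x ∷ xs) ys = begin
  sum (map w (map (x ,_) ys ++ cartesianProduct xs ys))
    ≡⟨ cong sum (map-++ w (map (x ,_) ys) _) ⟩
  sum (map w (map (x ,_) ys) ++ map w (cartesianProduct xs ys))
    ≡⟨ sum-++ (map w (map (x ,_) ys)) _ ⟩
  sum (map w (map (x ,_) ys)) + sum (map w (cartesianProduct xs ys))
    ≡⟨ cong₂ _+_ (trans (cong sum (sym (map-∘ ys))) (row ys)) (sum-cartesianProduct g h xs ys) ⟩
  length ys * g x + sum (map h ys) + (length ys * sum (map g xs) + length xs * sum (map h ys))
    ≡⟨ regroup (length ys) (g x) (sum (map h ys)) (sum (map g xs)) (length xs) ⟩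
  length ys * (g x + sum (map g xs)) + suc (length xs) * sum (map h ys) ∎
  where
  open ≡-Reasoning
  w = λ { (x , y) → g x + h y }
  regroup : ∀ l a b c e → l * a + b + (l * c + e * b) ≡ l * (a + c) + suc e * b
  regroup = solve-∀
  row : ∀ ys → sum (map (λ y → g x + h y) ys) ≡ length ys * g x + sum (map h ys)
  row []       = refl
  row (y ∷ ys) = trans (cong (g x + h y +_) (row ys)) (rearrange (g x) (h y) (length ys) (sum (map h ys)))
    where
    rearrange : ∀ a b l s → a + b + (l * a + s) ≡ suc l * a + (b + s)
    rearrange = solve-∀

sum-allFin : ∀ (g : ℕ → ℕ) n → sum (map (g ∘ toℕ) (allFin n)) ≡ sum (applyUpTo g n)
sum-allFin g n = trans (cong sum (map-tabulate {n = n} (λ i → i) (g ∘ toℕ))) (go g n)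
  where
  go : ∀ g n → sum (tabulate {n = n} (g ∘ toℕ)) ≡ sum (applyUpTo g n)
  go g zero    = refl
  go g (suc n) = cong (g 0 +_) (go (g ∘ suc) n)

-- Twice the distance from row y to the midpoint (m - 1)/2 of the path; doubling keeps it integral
-- for even m. `leafWeight` is on the same scale.
rowWeight : ℕ → ℕ → ℕ
rowWeight m y = ∣ 2 * y + 1 - m ∣

leafWeight : ℕ → ℕ
leafWeight zero    = 0
leafWeight (suc a) = 2

rowWeights : ℕ → ℕ
rowWeights m = sum (applyUpTo (rowWeight m) m)

totalWeight : ℕ → ℕ → ℕ
totalWeight m n = suc n * rowWeights m + m * (2 * n)

-- Adding a row at each end moves indices and midpoint together, so the old weights survive and each
-- new end weighs m + 1.
rowWeights-2+ : ∀ m → rowWeights (2 + m) ≡ rowWeights m + 2 * (1 + m)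
rowWeights-2+ m = begin
  suc m + sum (applyUpTo (rowWeight (2 + m) ∘ suc) (suc m)) ≡⟨ cong (suc m +_) (snoc (rowWeight (2 + m) ∘ suc) m) ⟩
  suc m + (sum (applyUpTo (rowWeight (2 + m) ∘ suc) m) + ∣ 2 * suc m + 1 - (2 + m) ∣)
    ≡⟨ cong₂ (λ a b → suc m + (a + b)) (inner m (λ y → cong (λ e → ∣ e - (2 + m) ∣) (double y))) last ⟩
  suc m + (rowWeights m + suc m) ≡⟨ regroup (rowWeights m) m ⟩
  rowWeights m + 2 * (1 + m) ∎
  where
  open ≡-Reasoning
  snoc : ∀ g n → sum (applyUpTo g (suc n)) ≡ sum (applyUpTo g n) + g n
  snoc g zero    = +-identityʳ (g 0)
  snoc g (suc n) = trans (cong (g 0 +_) (snoc (g ∘ suc) n)) (sym (+-assoc (g 0) _ _))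
  inner : ∀ n {g h : ℕ → ℕ} → (∀ y → g y ≡ h y) → sum (applyUpTo g n) ≡ sum (applyUpTo h n)
  inner zero    eq = refl
  inner (suc n) eq = cong₂ _+_ (eq 0) (inner n (eq ∘ suc))
  double : ∀ y → 2 * suc y + 1 ≡ 2 + (2 * y + 1)
  double = solve-∀
  top : ∀ m → 2 * suc m + 1 ≡ 2 + m + suc m
  top = solve-∀
  last : ∣ 2 * suc m + 1 - (2 + m) ∣ ≡ suc m
  last = trans (cong (λ e → ∣ e - (2 + m) ∣) (top m)) (trans (∣-∣-comm (2 + m + suc m) (2 + m)) (∣m-m+n∣≡n (2 + m) (suc m)))
  regroup : ∀ s m → suc m + (s + suc m) ≡ s + 2 * (1 + m)
  regroup = solve-∀

rowWeights-even : ∀ k → rowWeights (k + k) ≡ 2 * (k * k)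
rowWeights-even zero    = refl
rowWeights-even (suc k) = trans (cong rowWeights (cong suc (+-suc k k))) (trans (rowWeights-2+ (k + k))
  (trans (cong (_+ 2 * (1 + (k + k))) (rowWeights-even k)) (square k)))
  where
  square : ∀ k → 2 * (k * k) + 2 * (1 + (k + k)) ≡ 2 * (suc k * suc k)
  square = solve-∀

rowWeights-odd : ∀ k → rowWeights (suc (k + k)) ≡ 2 * (k * suc k)
rowWeights-odd zero    = refl
rowWeights-odd (suc k) = trans (cong rowWeights (cong (suc ∘ suc) (+-suc k k))) (trans (rowWeights-2+ (suc (k + k)))
  (trans (cong (_+ 2 * (2 + (k + k))) (rowWeights-odd k)) (pronic k)))
  where
  pronic : ∀ k → 2 * (k * suc k) + 2 * (2 + (k + k)) ≡ 2 * (suc k * suc (suc k))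
  pronic = solve-∀

module LowerBound (m n : ℕ) where
  open Product m n

  weight : V G → ℕ
  weight (i , a) = rowWeight m (toℕ i) + leafWeight (toℕ a)

  private
    rows≤ : ∀ y y′ → 2 * ∣ y - y′ ∣ ≤ rowWeight m y + rowWeight m y′
    rows≤ y y′ = begin
      2 * ∣ y - y′ ∣                                ≡⟨ *-distribˡ-∣-∣ 2 y y′ ⟩
      ∣ 2 * y - 2 * y′ ∣                            ≡⟨ ∣m+n-m+o∣≡∣n-o∣ 1 (2 * y) (2 * y′) ⟨
      ∣ 1 + 2 * y - 1 + 2 * y′ ∣                    ≡⟨ cong₂ ∣_-_∣ (+-comm 1 (2 * y)) (+-comm 1 (2 * y′)) ⟩
      -- On the scale 2 y + 1 the midpoint of the path is m, here the intermediate point.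
      ∣ 2 * y + 1 - 2 * y′ + 1 ∣                    ≤⟨ ∣-∣-triangle (2 * y + 1) m (2 * y′ + 1) ⟩
      ∣ 2 * y + 1 - m ∣ + ∣ m - 2 * y′ + 1 ∣        ≡⟨ cong (rowWeight m y +_) (∣-∣-comm m (2 * y′ + 1)) ⟩
      rowWeight m y + rowWeight m y′                ∎
      where open ≤-Reasoning

    leaves≤ : ∀ a b → 2 * starDist a b ≤ leafWeight a + leafWeight b
    leaves≤ zero    zero    = z≤n
    leaves≤ zero    (suc b) = ≤-refl
    leaves≤ (suc a) zero    = ≤-refl
    leaves≤ (suc a) (suc b) = *-monoʳ-≤ 2 (starDist≤2 (suc a) (suc b))

  2*dist≤weights : ∀ u v → 2 * dist u v ≤ weight u + weight v
  2*dist≤weights (i , a) (j , b) = linear (+-mono-≤ (rows≤ (toℕ i) (toℕ j)) (leaves≤ (toℕ a) (toℕ b))) 0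
    (eq (∣ toℕ i - toℕ j ∣) (starDist (toℕ a) (toℕ b)) (rowWeight m (toℕ i)) (rowWeight m (toℕ j)) _ _)
    where
    eq : ∀ d s p q a b → 2 * (d + s) + (p + q + (a + b)) + 0 ≡ p + a + (q + b) + (2 * d + 2 * s)
    eq = solve-∀

  vertices : List (V G)
  vertices = cartesianProduct (allFin m) (allFin (suc n))

  length-vertices : length vertices ≡ m * suc n
  length-vertices = trans (length-cartesianProduct (allFin m) (allFin (suc n)))
    (cong₂ _*_ (length-tabulate {n = m} (λ i → i)) (length-tabulate {n = suc n} (λ i → i)))

  sum-weights : sum (map weight vertices) ≡ totalWeight m n
  sum-weights = trans (sum-cartesianProduct (rowWeight m ∘ toℕ) (leafWeight ∘ toℕ) (allFin m) (allFin (suc n)))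
    (cong₂ _+_ (cong₂ _*_ (length-tabulate {n = suc n} (λ i → i)) (sum-allFin (rowWeight m) m))
               (cong₂ _*_ (length-tabulate {n = m} (λ i → i)) (trans (sum-allFin leafWeight (suc n)) (twos n))))
    where
    twos : ∀ n → sum (applyUpTo (λ _ → 2) n) ≡ 2 * n
    twos zero    = refl
    twos (suc n) = trans (cong (2 +_) (twos n)) (sym (*-suc 2 n))

  module _ (f : V G → ℕ) (separated : ∀ u v → u ≢ v → m + 2 ≤ ∣ f u - f v ∣ + dist u v) where

    open Sort (On.decTotalOrder ≤-decTotalOrder f) using (sort; sort-↭; sort-↗)

    private
      -- The radio condition for neighbours in label order, doubled and with 2 d replaced by the
      -- weights. Free of distances, it telescopes.
      Link : V G → V G → Set
      Link u v = 2 * f u + 2 * (m + 2) ≤ 2 * f v + (weight u + weight v)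

      link : ∀ {u v} → f u ≤ f v → u ≢ v → Link u v
      link {u} {v} le u≢v = linear (+-mono-≤ (*-monoʳ-≤ 2 far) (2*dist≤weights u v)) 0
        (eq (f u) (f v) (m + 2) (dist u v) (weight u) (weight v))
        where
        far : f u + (m + 2) ≤ f v + dist u v
        far = begin
          f u + (m + 2)                        ≤⟨ +-monoʳ-≤ (f u) (separated u v u≢v) ⟩
          f u + (∣ f u - f v ∣ + dist u v)     ≡⟨ +-assoc (f u) _ _ ⟨
          f u + ∣ f u - f v ∣ + dist u v       ≡⟨ cong (λ d → f u + d + dist u v) (m≤n⇒∣m-n∣≡n∸m le) ⟩
          f u + (f v ∸ f u) + dist u v         ≡⟨ cong (_+ dist u v) (m+[n∸m]≡n le) ⟩
          f v + dist u v                       ∎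
          where open ≤-Reasoning
        eq : ∀ a b c d p q → 2 * a + 2 * c + (2 * (b + d) + (p + q)) + 0 ≡ 2 * b + (p + q) + (2 * (a + c) + 2 * d)
        eq = solve-∀

      links : ∀ {us} → Linked (λ u v → f u ≤ f v) us → Unique us → Linked Link us
      links []          []                       = []
      links [-]         _                        = [-]
      links (le ∷ les) ((u≢v All.∷ _) ∷ unique) = link le u≢v ∷ links les unique

      sorted-unique : Unique (sort vertices)
      sorted-unique = SetoidPermutation.Unique-resp-↭ (setoid (V G)) (↭⇒↭ₛ (↭-sym (sort-↭ vertices)))
        (cartesianProduct⁺ (allFin⁺ m) (allFin⁺ (suc n)))

      -- `chain` runs on the tail only, so that the last vertex is found there and uniqueness
      -- separates it from the first; their distance of at least 1 gives the extra 2.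
      extremes : ∀ us → Linked Link us → Unique us → 2 ≤ length us →
        ∃ λ u → ∃ λ v → 2 * f u + 2 * (m + 2) * length us + 2 ≤ 2 * f v + 2 * sum (map weight us) + 2 * (m + 2)
      extremes (u ∷ []) _ _ (s≤s ())
      extremes (u ∷ u′ ∷ us) (l ∷ ls) (u∉ ∷ _) _ with chain f weight (m + 2) u′ us ls
      ... | v , v∈ , le = u , v , linear (+-mono-≤ (+-mono-≤ l le) (≤-trans (*-monoʳ-≤ 2 positive) (2*dist≤weights u v))) 0
        (eq (f u) (f u′) (f v) (weight u) (weight u′) (weight v) (m + 2) (length us) (sum (map weight us)))
        where
        positive : 1 ≤ dist u v
        positive = n≢0⇒n>0 (All.lookup u∉ v∈ ∘ dist≡0⇒≡ u v)
        eq : ∀ a a′ b p p′ q c l s →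
          2 * a + 2 * c * suc (suc l) + 2 + (2 * a′ + (p + p′) + (2 * b + 2 * (p′ + s)) + (p + q)) + 0 ≡
          2 * b + 2 * (p + (p′ + s)) + 2 * c + (2 * a + 2 * c + (2 * a′ + 2 * c * l + (p′ + q)) + 2 * 1)
        eq = solve-∀

    -- With N vertices of total weight W this reads s ≥ (m + 2)(N - 1) - W + 1, cleared of
    -- subtraction.
    span-bound : 2 ≤ m * suc n → ∀ {s} → Span G f s → (m + 2) * (m * suc n) + 1 ≤ s + totalWeight m n + (m + 2)
    span-bound 2≤N {s} (a , b , bounds , refl)
      with extremes (sort vertices) (links (sort-↗ vertices) sorted-unique) sorted-unique
             (subst (2 ≤_) (sym (trans (↭-length (sort-↭ vertices)) length-vertices)) 2≤N)
    ... | u , v , le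
      rewrite trans (↭-length (sort-↭ vertices)) length-vertices
            | trans (sum-↭ (map⁺ weight (sort-↭ vertices))) sum-weights =
      *-cancelˡ-≤ 2 (linear (+-mono-≤ le (*-monoʳ-≤ 2 width)) 0 (eq (f u) (f v) (m + 2) (m * suc n) (f b ∸ f a) (totalWeight m n)))
      where
      -- The ends of the sorted list need not be a and b themselves; it suffices that all labels lie
      -- between f a and f b.
      width : f v ≤ f u + (f b ∸ f a)
      width = begin
        f v                       ≤⟨ proj₂ (bounds v) ⟩
        f b                       ≤⟨ m≤n+m∸n (f b) (f a) ⟩
        f a + (f b ∸ f a)         ≤⟨ +-monoˡ-≤ (f b ∸ f a) (proj₁ (bounds u)) ⟩
        f u + (f b ∸ f a)         ∎
        where open ≤-Reasoning
      eq : ∀ x y c l s t → 2 * (c * l + 1) + (2 * y + 2 * t + 2 * c + 2 * (x + s)) + 0 ≡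
                           2 * (s + t + c) + (2 * x + 2 * c * l + 2 + 2 * y)
      eq = solve-∀

-- Reduces the theorem to exhibiting a labelling: the last equation says that r attains the bound of
-- `span-bound`.
radioNumber : ∀ m n → 3 ≤ m → 3 ≤ n → let open Product m n in
  (f : V G → ℕ) (a b : V G) →
  (∀ u v → u ≢ v → m + 2 ≤ ∣ f u - f v ∣ + dist u v) →
  (∀ w → f a ≤ f w × f w ≤ f b) →
  ∀ r → f b ≡ f a + r → r + totalWeight m n + (m + 2) ≡ (m + 2) * (m * suc n) + 1 →
  IsRadioNumber G r
radioNumber (suc _) 1 _ (s≤s ())
radioNumber m@(suc m₀) n@(suc (suc n₀)) 3≤m 3≤n f a b separated bounds r width tight =
  m + 1 , diameter m₀ n₀ , (f , radio , (a , b , bounds , trans (cong (_∸ f a) width) (m+n∸m≡n (f a) r))) , minimal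
  where
  open Product m n
  radio : IsRadioLabeling G (m + 1) f
  radio u v u≢v k d rewrite Dist⇒≡dist d = m≤n+o⇒m∸n≤o (m + 1 + 1) (dist u v)
    (≤-trans (≤-reflexive (+-assoc m 1 1)) (≤-trans (separated u v u≢v) (≤-reflexive (+-comm _ (dist u v)))))
  minimal : ∀ g s → IsRadioLabeling G (m + 1) g → Span G g s → r ≤ s
  minimal g s radio-g span-g = +-cancelʳ-≤ (totalWeight m n) r s (+-cancelʳ-≤ (m + 2) _ _
    (≤-trans (≤-reflexive tight) (LowerBound.span-bound m n g sep two span-g)))
    where
    two : 2 ≤ m * suc n
    two = *-mono-≤ (≤-trans (s≤s z≤n) 3≤m) (≤-trans (s≤s (s≤s z≤n)) (≤-trans 3≤n (n≤1+n n)))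
    sep : ∀ u v → u ≢ v → m + 2 ≤ ∣ g u - g v ∣ + dist u v
    sep u v u≢v = ≤-trans (≤-reflexive (sym (+-assoc m 1 1))) (≤-trans (m≤n+m∸n (m + 1 + 1) (dist u v))
      (≤-trans (≤-reflexive (+-comm (dist u v) _)) (+-monoˡ-≤ (dist u v) (radio-g u v u≢v (dist u v) (Dist-dist u v)))))

-- Labels from slots and criteria for separation

-- A slot ⟨ t , z , φ ⟩ carries the label t M + z + φ: t is the position of the pair in the visiting
-- order, z the (possibly renumbered) row, and φ the delay caused by the star centres visited so far
-- (each step costs one more for every endpoint over the centre, as its distance is one shorter).
record Slot : Set where
  constructor ⟨_,_,_⟩
  field time row extra : ℕ
open Slot

label : ℕ → Slot → ℕ
label M σ = time σ * M + row σ + extra σ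

-- δ and s stand for the distances of the rows and of the star vertices.
record Sep (M δ s : ℕ) (σ τ : Slot) : Set where
  constructor sep
  field gap : label M σ + (M + 2) ≤ label M τ + (δ + s)

Apart : (M δ s : ℕ) (σ τ : Slot) → Set
Apart M δ s σ τ = Sep M δ s σ τ ⊎ Sep M δ s τ σ

-- The later time supplies M and the row distance repays any drop of rows. What remains of M + 2 is
-- 2, shared between delay and star distance.
sep-next : ∀ {M δ s t z φ t′ z′ φ′} → t < t′ → φ + 2 ≤ φ′ + s → z ≤ z′ + δ →
  Sep M δ s ⟨ t , z , φ ⟩ ⟨ t′ , z′ , φ′ ⟩
sep-next {M} {δ} {s} {t} {z} {φ} {t′} {z′} {φ′} lt le tri =
  sep (linear (+-mono-≤ (*-monoˡ-≤ M lt) (+-mono-≤ le tri)) 0 (eq M δ s t z φ t′ z′ φ′))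
  where
  eq : ∀ M δ s t z φ t′ z′ φ′ → t * M + z + φ + (M + 2) + (t′ * M + (φ′ + s + (z′ + δ))) + 0 ≡
    t′ * M + z′ + φ′ + (δ + s) + (suc t * M + (φ + 2 + z))
  eq = solve-∀

-- Two time units supply 2 M, and the spare M covers the 2 without any star distance; made for equal
-- leaves.
sep-far : ∀ {M δ s t z φ t′ z′ φ′} → 2 ≤ M → 2 + t ≤ t′ → φ ≤ φ′ → z ≤ z′ + δ →
  Sep M δ s ⟨ t , z , φ ⟩ ⟨ t′ , z′ , φ′ ⟩
sep-far {M} {δ} {s} {t} {z} {φ} {t′} {z′} {φ′} 2≤M lt le tri =
  sep (linear (+-mono-≤ 2≤M (+-mono-≤ (*-monoˡ-≤ M lt) (+-mono-≤ le tri))) s (eq M δ s t z φ t′ z′ φ′))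
  where
  eq : ∀ M δ s t z φ t′ z′ φ′ → t * M + z + φ + (M + 2) + (M + (t′ * M + (φ′ + (z′ + δ)))) + s ≡
    t′ * M + z′ + φ′ + (δ + s) + (2 + ((2 + t) * M + (φ + z)))
  eq = solve-∀

-- Serves equal times: a rise by d counts twice, in the labels and in the distance, and e is what
-- the distance δ has beyond the difference of row numbers.
sep-span : ∀ d e {M δ s t z φ t′ z′ φ′} → t ≤ t′ → z + d ≤ z′ → φ + (M + 2) ≤ φ′ + s + (2 * d + e) → z′ + e ≤ z + δ →
  Sep M δ s ⟨ t , z , φ ⟩ ⟨ t′ , z′ , φ′ ⟩
sep-span d e {M} {δ} {s} {t} {z} {φ} {t′} {z′} {φ′} lt rise le tri =
  sep (linear (+-mono-≤ (*-monoʳ-≤ 2 rise) (+-mono-≤ (*-monoˡ-≤ M lt) (+-mono-≤ le tri))) 0 (eq d e M δ s t z φ t′ z′ φ′))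
  where
  eq : ∀ d e M δ s t z φ t′ z′ φ′ →
    t * M + z + φ + (M + 2) + (2 * z′ + (t′ * M + (φ′ + s + (2 * d + e) + (z + δ)))) + 0 ≡
    t′ * M + z′ + φ′ + (δ + s) + (2 * (z + d) + (t * M + (φ + (M + 2) + (z′ + e))))
  eq = solve-∀

-- For equal leaves at consecutive times: a rise by one row counts twice and so replaces the missing
-- star distance of 2.
sep-rise : ∀ {M δ s t z φ t′ z′ φ′} → t < t′ → φ ≤ φ′ → z < z′ → z′ ≤ z + δ →
  Sep M δ s ⟨ t , z , φ ⟩ ⟨ t′ , z′ , φ′ ⟩
sep-rise {M} {δ} {s} {t} {z} {φ} {t′} {z′} {φ′} lt le rise tri =
  sep (linear (+-mono-≤ (*-monoʳ-≤ 2 rise) (+-mono-≤ (*-monoˡ-≤ M lt) (+-mono-≤ le tri))) s (eq M δ s t z φ t′ z′ φ′))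
  where
  eq : ∀ M δ s t z φ t′ z′ φ′ →
    t * M + z + φ + (M + 2) + (2 * z′ + (t′ * M + (φ′ + (z + δ)))) + s ≡
    t′ * M + z′ + φ′ + (δ + s) + (2 * suc z + (suc t * M + (φ + z′)))
  eq = solve-∀

-- The two halves of a pair: their rows are half of M apart, and counting this twice yields M.
sep-pair : ∀ {k δ s t z φ t′ z′ φ′} → t ≤ t′ → z + k ≤ z′ → φ + 2 ≤ φ′ + s → z′ ≤ z + δ →
  Sep (k + k) δ s ⟨ t , z , φ ⟩ ⟨ t′ , z′ , φ′ ⟩
sep-pair {k} {s = s} {φ = φ} {z′ = z′} {φ′ = φ′} lt rise le tri =
  sep-span k 0 lt rise (linear le 0 (eq k s φ φ′)) (≤-trans (≤-reflexive (+-identityʳ z′)) tri)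
  where
  eq : ∀ k s φ φ′ → φ + (k + k + 2) + (φ′ + s) + 0 ≡ φ′ + s + (2 * k + 0) + (φ + 2)
  eq = solve-∀

label-mono : ∀ {M t z φ t′ z′ φ′} → t < t′ → z ≤ M → φ ≤ φ′ → label M ⟨ t , z , φ ⟩ ≤ label M ⟨ t′ , z′ , φ′ ⟩
label-mono {M} {t} {z} {φ} {t′} {z′} {φ′} lt z≤M le =
  linear (+-mono-≤ (*-monoˡ-≤ M lt) (+-mono-≤ z≤M le)) z′ (eq M t z φ t′ z′ φ′)
  where
  eq : ∀ M t z φ t′ z′ φ′ → t * M + z + φ + (t′ * M + (M + φ′)) + z′ ≡ t′ * M + z′ + φ′ + (suc t * M + (z + φ))
  eq = solve-∀

gap⇒∣-∣ : ∀ a b {c d} → a + c ≤ b + d → c ≤ ∣ a - b ∣ + d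
gap⇒∣-∣ a b {c} {d} le = +-cancelˡ-≤ a c _ (≤-trans le
  (≤-trans (+-monoˡ-≤ d (m≤n+∣n-m∣ b a)) (≤-reflexive (+-assoc a _ d))))

Apart⇒∣-∣ : ∀ {M δ s σ τ} → Apart M δ s σ τ → M + 2 ≤ ∣ label M σ - label M τ ∣ + (δ + s)
Apart⇒∣-∣ {M} {σ = σ} {τ} (inj₁ (sep le)) = gap⇒∣-∣ (label M σ) (label M τ) le
Apart⇒∣-∣ {M} {δ} {s} {σ} {τ} (inj₂ (sep le)) =
  subst (λ d → M + 2 ≤ d + (δ + s)) (∣-∣-comm (label M τ) (label M σ)) (gap⇒∣-∣ (label M τ) (label M σ) le)

apart-cmp : ∀ {M δ s t z φ t′ z′ φ′} → z ≤ z′ + δ → z′ ≤ z + δ →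
  (t < t′ → φ + 2 ≤ φ′ + s) → (t′ < t → φ′ + 2 ≤ φ + s) →
  (t ≡ t′ → Apart M δ s ⟨ t , z , φ ⟩ ⟨ t′ , z′ , φ′ ⟩) → Apart M δ s ⟨ t , z , φ ⟩ ⟨ t′ , z′ , φ′ ⟩
apart-cmp {t = t} {t′ = t′} tri tri′ before after same with <-cmp t t′
... | tri< lt _ _ = inj₁ (sep-next lt (before lt) tri)
... | tri≈ _ eq _ = same eq
... | tri> _ _ gt = inj₂ (sep-next gt (after gt) tri′)

round< : ∀ {k R R′ x x′} → R < R′ → x < k → R * k + x < R′ * k + x′
round< {k} {R} {R′} {x} {x′} lt x<k = linear (+-mono-≤ (*-monoˡ-≤ k lt) x<k) x′ (eq k R R′ x x′)
  where
  eq : ∀ k R R′ x x′ → suc (R * k + x) + (R′ * k + k) + x′ ≡ R′ * k + x′ + (suc R * k + suc x)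
  eq = solve-∀

round-far : ∀ {k R R′ x x′} → 2 ≤ k → 2 + R ≤ R′ → x < k → 2 + (R * k + x) ≤ R′ * k + x′
round-far {k} {R} {R′} {x} {x′} 2≤k lt x<k = linear (+-mono-≤ 2≤k (+-mono-≤ (*-monoˡ-≤ k lt) (<⇒≤ x<k))) x′ (eq k R R′ x x′)
  where
  eq : ∀ k R R′ x x′ → 2 + (R * k + x) + (k + (R′ * k + k)) + x′ ≡ R′ * k + x′ + (2 + ((2 + R) * k + x))
  eq = solve-∀

digits : ∀ {k R R′ x x′} → x < k → x′ < k → R * k + x ≡ R′ * k + x′ → R ≡ R′ × x ≡ x′
digits {k} {R} {R′} x<k x′<k eq with <-cmp R R′
... | tri< lt _ _   = ⊥-elim (<⇒≢ (round< lt x<k) eq)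
... | tri> _ _ gt   = ⊥-elim (<⇒≢ (round< gt x′<k) (sym eq))
... | tri≈ _ refl _ = refl , +-cancelˡ-≡ (R * k) _ _ eq

by-leaf : ∀ {A : Set} i j → (i ≡ j → A) → (i ≢ j → A) → A
by-leaf i j same distinct with i ≟ j
... | yes eq = same eq
... | no ne  = distinct ne

-- Even m = 2k

-- Vertex (y , a) is over the centre if a = 0 and over the i-th leaf if a = suc i.  For a leaf, R is the
-- round in which it is visited in row y, and the time is R k + (y mod k).
module Even (k n : ℕ) (2≤k : 2 ≤ k) (3≤n : 3 ≤ n) where

  -- Counting leaves from 0 and modulo n, round R has leaf R - 1 on the left and R - 2 on the right,
  -- so partners differ, and a leaf passes from left to right in the next round. Row 0 skips round
  -- 1, its time k being taken by its centre vertex, and meets leaf 0 in round n + 1 instead.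
  data Roundˡ : (x i R : ℕ) → Set where
    inner : ∀ {x i} → i < n → Roundˡ (suc x) i (1 + i)
    outer : ∀ {i} → suc i < n → Roundˡ 0 (suc i) (2 + i)
    wrap  : Roundˡ 0 0 (suc n)

  data Roundʳ : (i R : ℕ) → Set where
    step : ∀ {i} → suc i < n → Roundʳ i (2 + i)
    wrap : ∀ {i} → suc i ≡ n → Roundʳ i 1

  -- The descending round, at times 1 to k. A step between two centre vertices costs a delay of 2,
  -- hence 4 per pair. Row k is missing because its centre vertex is kept for the end.
  data Centre : (y : ℕ) → Slot → Set where
    left  : ∀ {x t} → x + t ≡ k → 0 < t → Centre x ⟨ t , x , 4 * t ⟩
    right : ∀ {x t} → 0 < x → x + t ≡ k → 0 < t → Centre (k + x) ⟨ t , k + x , 4 * t + 2 ⟩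

  -- The descending round stops at (0 , 0) with delay 4 k; entering the leaves costs one more, steps
  -- between different leaves cost nothing, and `end` costs the last unit.
  data Leaf : (y i : ℕ) → Slot → Set where
    left  : ∀ {x i R} → x < k → Roundˡ x i R → Leaf x i ⟨ R * k + x , x , 4 * k + 1 ⟩
    right : ∀ {x i R} → x < k → Roundʳ i R → Leaf (k + x) i ⟨ R * k + x , k + x , 4 * k + 1 ⟩

  end : Slot
  end = ⟨ suc n * k , k , 4 * k + 2 ⟩

  data At : (y a : ℕ) → Slot → Set where
    centre : ∀ {y σ} → Centre y σ → At y 0 σ
    final  : At k 0 end
    leaf   : ∀ {y i σ} → Leaf y i σ → At y (suc i) σ

  0<k : 0 < k
  0<k = ≤-trans (s≤s z≤n) 2≤k

  2≤k+k : 2 ≤ k + k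
  2≤k+k = ≤-trans 2≤k (m≤m+n k k)

  Roundˡ-injective : ∀ {x i j R} → Roundˡ x i R → Roundˡ x j R → i ≡ j
  Roundˡ-injective (inner _) (inner _) = refl
  Roundˡ-injective (outer _) (outer _) = refl
  Roundˡ-injective (outer i<n) wrap    = ⊥-elim (<-irrefl refl i<n)
  Roundˡ-injective wrap (outer i<n)    = ⊥-elim (<-irrefl refl i<n)
  Roundˡ-injective wrap wrap           = refl

  Roundʳ-injective : ∀ {i j R} → Roundʳ i R → Roundʳ j R → i ≡ j
  Roundʳ-injective (step _)   (step _)    = refl
  Roundʳ-injective (wrap eq) (wrap eq′) = suc-injective (trans eq (sym eq′))

  Roundʳ-functional : ∀ {i R R′} → Roundʳ i R → Roundʳ i R′ → R ≡ R′
  Roundʳ-functional (step _)  (step _)  = refl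
  Roundʳ-functional (step lt) (wrap eq) = ⊥-elim (<⇒≢ lt eq)
  Roundʳ-functional (wrap eq) (step lt) = ⊥-elim (<⇒≢ lt eq)
  Roundʳ-functional (wrap _)  (wrap _)  = refl

  -- All left rows meet a leaf in one round, except that row 0 meets leaf 0 a full n rounds after
  -- the others.
  roundsˡ : ∀ {x x′ i R R′} → Roundˡ x i R → Roundˡ x′ i R′ → R ≡ R′ ⊎ (2 + R ≤ R′ ⊎ 2 + R′ ≤ R)
  roundsˡ (inner _) (inner _) = inj₁ refl
  roundsˡ (inner _) (outer _) = inj₁ refl
  roundsˡ (inner _) wrap      = inj₂ (inj₁ (≤-trans 3≤n (n≤1+n n)))
  roundsˡ (outer _) (inner _) = inj₁ refl
  roundsˡ (outer _) (outer _) = inj₁ refl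
  roundsˡ wrap (inner _)      = inj₂ (inj₂ (≤-trans 3≤n (n≤1+n n)))
  roundsˡ wrap wrap           = inj₁ refl

  -- The first alternative is the regular shift; where the shift wraps around modulo n, n ≥ 3 leaves
  -- two rounds between.
  roundsˡʳ : ∀ {x i R R′} → Roundˡ x i R → Roundʳ i R′ → suc R ≡ R′ ⊎ 2 + R′ ≤ R
  roundsˡʳ (inner _) (step _)    = inj₁ refl
  roundsˡʳ (inner _) (wrap eq)   = inj₂ (≤-trans 3≤n (≤-reflexive (sym eq)))
  roundsˡʳ (outer _) (step _)    = inj₁ refl
  roundsˡʳ (outer _) (wrap eq)   = inj₂ (≤-trans 3≤n (≤-reflexive (sym eq)))
  roundsˡʳ wrap      (step _)    = inj₂ (s≤s 3≤n)
  roundsˡʳ wrap      (wrap refl) = ⊥-elim (<⇒≱ 3≤n (s≤s z≤n))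

  leafˡ-late : ∀ {x i R} → Roundˡ x i R → k < R * k + x
  leafˡ-late (inner {x} {i} _) = begin-strict
    k                      ≤⟨ m≤m+n k (i * k) ⟩
    suc i * k              <⟨ m<m+n (suc i * k) (s≤s z≤n) ⟩
    suc i * k + suc x      ∎
    where open ≤-Reasoning
  leafˡ-late (outer {i} _) = begin-strict
    k                      <⟨ m<m+n k 0<k ⟩
    k + k                  ≤⟨ +-monoʳ-≤ k (m≤m+n k (i * k)) ⟩
    (2 + i) * k            ≤⟨ m≤m+n _ 0 ⟩
    (2 + i) * k + 0        ∎
    where open ≤-Reasoning
  leafˡ-late wrap = begin-strict
    k                      <⟨ m<m+n k 0<k ⟩
    k + k                  ≡⟨ cong (k +_) (+-identityʳ k) ⟨
    2 * k                  ≤⟨ *-monoˡ-≤ k (≤-trans (s≤s (s≤s z≤n)) (≤-trans 3≤n (n≤1+n n))) ⟩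
    suc n * k              ≤⟨ m≤m+n _ 0 ⟩
    suc n * k + 0          ∎
    where open ≤-Reasoning

  -- Not strict, unlike on the left: row k over leaf n - 1 shares time k with (0 , 0).
  leafʳ-late : ∀ {x i R} → Roundʳ i R → k ≤ R * k + x
  leafʳ-late (step _) = ≤-trans (m≤m+n k _) (m≤m+n _ _)
  leafʳ-late (wrap _) = ≤-trans (m≤m+n k _) (m≤m+n _ _)

  before-end : ∀ {x R} → R < suc n → x < k → R * k + x < suc n * k
  before-end {x} {R} lt x<k = subst (R * k + x <_) (+-identityʳ (suc n * k)) (round< {k} {R} {suc n} lt x<k)

  leafʳ-early : ∀ {x i R} → x < k → Roundʳ i R → R * k + x < suc n * k
  leafʳ-early {x} x<k (step {i} lt) = before-end {x} {2 + i} (s≤s lt) x<k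
  leafʳ-early {x} x<k (wrap _)      = before-end {x} {1} (s≤s (≤-trans (s≤s z≤n) 3≤n)) x<k

  -- A time unit of the descending round holds two steps with two centre endpoints each.
  four : ∀ {t t′} → t < t′ → 4 * t + 4 ≤ 4 * t′
  four {t} {t′} lt = ≤-trans (≤-reflexive (trans (+-comm (4 * t) 4) (sym (*-suc 4 t)))) (*-monoʳ-≤ 4 lt)

  four₀ : ∀ {t t′} → t < t′ → 4 * t + 2 ≤ 4 * t′ + 0
  four₀ {t} {t′} lt = linear (four lt) 2 (eq (4 * t) (4 * t′))
    where
    eq : ∀ a b → a + 2 + b + 2 ≡ b + 0 + (a + 4)
    eq = solve-∀

  four₂ : ∀ {t t′} → t < t′ → 4 * t + 2 ≤ 4 * t′ + 2 + 0
  four₂ {t} {t′} lt = ≤-trans (four₀ {t} {t′} lt) (+-monoˡ-≤ 0 (m≤m+n (4 * t′) 2))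

  four₋ : ∀ {t t′} → t < t′ → 4 * t + 2 + 2 ≤ 4 * t′ + 0
  four₋ {t} {t′} lt = ≤-trans (≤-reflexive (+-assoc (4 * t) 2 2)) (≤-trans (four lt) (m≤m+n _ 0))

  four₂₂ : ∀ {t t′} → t < t′ → 4 * t + 2 + 2 ≤ 4 * t′ + 2 + 0
  four₂₂ {t} {t′} lt = ≤-trans (four₋ {t} {t′} lt) (+-monoˡ-≤ 0 (m≤m+n _ 2))

  same-row : ∀ {x x′ t t′} → x + t ≡ k → x′ + t′ ≡ k → t ≡ t′ → x ≡ x′
  same-row {x} {x′} {t} p p′ refl = +-cancelʳ-≡ t x x′ (trans p (sym p′))

  shift : ∀ {x x′} → x ≡ x′ → x + k ≤ k + x′
  shift {x} refl = ≤-reflexive (+-comm x k)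

  t≤k : ∀ x {t} → x + t ≡ k → t ≤ k
  t≤k x {t} p = ≤-trans (m≤n+m t x) (≤-reflexive p)

  t<k : ∀ {x} {t} → 0 < x → x + t ≡ k → t < k
  t<k {x} {t} 0<x p = ≤-trans (+-monoˡ-≤ t 0<x) (≤-reflexive p)

  k<end : k < suc n * k
  k<end = m<m+n k (*-mono-≤ (≤-trans (s≤s z≤n) 3≤n) 0<k)

  φ-pair : ∀ c → c + 2 ≤ c + 2 + 0
  φ-pair c = m≤m+n _ 0

  φ-leaf : ∀ {t} → t ≤ k → 4 * t + 2 ≤ 4 * k + 1 + 1
  φ-leaf {t} le = ≤-trans (+-monoˡ-≤ 2 (*-monoʳ-≤ 4 le)) (≤-reflexive (sym (+-assoc (4 * k) 1 1)))

  φ-leaf₂ : ∀ {t} → t < k → 4 * t + 2 + 2 ≤ 4 * k + 1 + 1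
  φ-leaf₂ {t} lt = ≤-trans (four₋ {t} {k} lt) (≤-trans (+-monoʳ-≤ (4 * k) z≤n) (≤-reflexive (sym (+-assoc (4 * k) 1 1))))

  φ-final : 4 * k + 1 + 2 ≤ 4 * k + 2 + 1
  φ-final = ≤-reflexive (trans (+-assoc (4 * k) 1 2) (sym (+-assoc (4 * k) 2 1)))

  late-centre : ∀ {x t T} → k ≤ T → x + t ≡ k → t ≡ T → x ≡ 0
  late-centre {x} {t} k≤T p refl = n≤0⇒n≡0 (+-cancelʳ-≤ t x 0 (≤-trans (≤-reflexive p) k≤T))

  leaves : ∀ {a b} → a ≢ b → ∀ φ → φ + 2 ≤ φ + starDist (suc a) (suc b)
  leaves a≢b φ = ≤-reflexive (cong (φ +_) (sym (starDist-leaves a≢b)))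

  module _ {δ : ℕ} where

    centre-centre : ∀ {y y′ σ τ} → Centre y σ → Centre y′ τ → y ≢ y′ →
      row σ ≤ row τ + δ → row τ ≤ row σ + δ → Apart (k + k) δ 0 σ τ
    centre-centre (left {x} {t} p _) (left {x′} {t′} p′ _) ne tri tri′ =
      apart-cmp tri tri′ (four₀ {t} {t′}) (four₀ {t′} {t}) (λ eq → ⊥-elim (ne (same-row {x} {x′} p p′ eq)))
    centre-centre (left {x} {t} p _) (right {x′} {t′} _ p′ _) ne tri tri′ =
      apart-cmp tri tri′ (four₂ {t} {t′}) (four₋ {t′} {t})
        (λ { refl → inj₁ (sep-pair ≤-refl (shift (same-row {x} {x′} p p′ refl)) (φ-pair (4 * t)) tri′) })
    centre-centre (right {x} {t} _ p _) (left {x′} {t′} p′ _) ne tri tri′ =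
      apart-cmp tri tri′ (four₋ {t} {t′}) (four₂ {t′} {t})
        (λ { refl → inj₂ (sep-pair ≤-refl (shift (same-row {x′} {x} p′ p refl)) (φ-pair (4 * t)) tri) })
    centre-centre (right {x} {t} _ p _) (right {x′} {t′} _ p′ _) ne tri tri′ =
      apart-cmp tri tri′ (four₂₂ {t} {t′}) (four₂₂ {t′} {t}) (λ eq → ⊥-elim (ne (cong (k +_) (same-row {x} {x′} p p′ eq))))

    centre-final : ∀ {y σ} → Centre y σ → row σ ≤ k + δ → Sep (k + k) δ 0 σ end
    centre-final (left {y} p _) tri =
      sep-next (≤-<-trans (t≤k y p) k<end) (≤-trans (+-monoˡ-≤ 2 (*-monoʳ-≤ 4 (t≤k y p))) (m≤m+n _ 0)) tri
    centre-final (right {y} {t} 0<x p _) tri = sep-next (<-trans (t<k {y} {t} 0<x p) k<end) (four₂₂ {t} {k} (t<k {y} {t} 0<x p)) tri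

    centre-leaf : ∀ {y y′ i σ τ} → Centre y σ → Leaf y′ i τ →
      row σ ≤ row τ + δ → row τ ≤ row σ + δ → Sep (k + k) δ 1 σ τ
    centre-leaf (left {y} p _) (left _ r) tri tri′ = sep-next (≤-<-trans (t≤k y p) (leafˡ-late r)) (φ-leaf (t≤k y p)) tri
    centre-leaf (left {y} p _) (right {x} _ r) tri tri′ with m≤n⇒m<n∨m≡n (≤-trans (t≤k y p) (leafʳ-late {x} r))
    ... | inj₁ lt = sep-next lt (φ-leaf (t≤k y p)) tri
    -- The only time shared by centre and leaf is k, and there the centre vertex lies in row 0.
    ... | inj₂ eq = sep-pair (≤-reflexive eq)
      (≤-trans (≤-reflexive (cong (_+ k) (late-centre {y} (leafʳ-late {x} r) p eq))) (m≤m+n k x)) (φ-leaf (t≤k y p)) tri′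
    centre-leaf (right {y} {t} 0<x p _) (left _ r) tri tri′ =
      sep-next (<-trans (t<k {y} {t} 0<x p) (leafˡ-late r)) (φ-leaf₂ (t<k {y} {t} 0<x p)) tri
    centre-leaf (right {y} {t} 0<x p _) (right _ r) tri tri′ =
      sep-next (<-≤-trans (t<k {y} {t} 0<x p) (leafʳ-late r)) (φ-leaf₂ (t<k {y} {t} 0<x p)) tri

    leaf-final : ∀ {y i σ} → Leaf y i σ → row σ ≤ k + δ → k ≤ row σ + δ → Sep (k + k) δ 1 σ end
    leaf-final (left {x} {i} x<k (inner i<n)) tri tri′ =
      sep-next (before-end {x} {suc i} (s≤s i<n) x<k) φ-final tri
    leaf-final (left {R = R} x<k (outer i<n)) tri tri′ =
      sep-next (before-end {0} {R} (s≤s i<n) x<k) φ-final tri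
    -- (0 , leaf 0) has the same time as `end`; the k rows between them make the pair.
    leaf-final (left x<k wrap) tri tri′ = sep-pair (≤-reflexive (+-identityʳ _)) ≤-refl φ-final tri′
    leaf-final (right x<k r) tri tri′ = sep-next (leafʳ-early x<k r) φ-final tri

    leaf-leaf : ∀ {y y′ i j σ τ} → Leaf y i σ → Leaf y′ j τ → (y ≡ y′ → i ≢ j) →
      row σ ≤ row τ + δ → row τ ≤ row σ + δ → Apart (k + k) δ (starDist (suc i) (suc j)) σ τ
    leaf-leafˡʳ : ∀ {x x′ i j R R′} → x < k → Roundˡ x i R → x′ < k → Roundʳ j R′ → x ≤ k + x′ + δ → k + x′ ≤ x + δ →
      Apart (k + k) δ (starDist (suc i) (suc j)) ⟨ R * k + x , x , 4 * k + 1 ⟩ ⟨ R′ * k + x′ , k + x′ , 4 * k + 1 ⟩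
    leaf-leafˡʳ {x} {x′} {i} {j} {R} {R′} x<k r x′<k r′ tri tri′ = by-leaf i j
      (λ { refl → same refl (roundsˡʳ r r′) })
      (λ i≢j → apart-cmp tri tri′ (λ _ → leaves i≢j _) (λ _ → leaves i≢j _)
        (λ eq → inj₁ (sep-pair (≤-reflexive eq) (shift (proj₂ (digits {k} {R} {R′} x<k x′<k eq))) (leaves i≢j _) tri′)))
      where
      same : i ≡ j → suc R ≡ R′ ⊎ 2 + R′ ≤ R → Apart (k + k) δ (starDist (suc i) (suc j)) _ _
      -- Row k - 1 and row k of the next round are consecutive in time; it helps that every right
      -- row lies above every left row.
      same refl (inj₁ refl) = inj₁ (sep-rise (round< {k} {R} ≤-refl x<k) ≤-refl (<-≤-trans x<k (m≤m+n k x′)) tri′)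
      same refl (inj₂ lt)   = inj₂ (sep-far 2≤k+k (round-far 2≤k lt x′<k) ≤-refl tri′)
    leaf-leaf {i = i} {j} (left {x} {R = R} x<k r) (left {x′} {R = R′} x′<k r′) ne tri tri′ = by-leaf i j
      (λ { refl → same refl (roundsˡ r r′) })
      (λ i≢j → apart-cmp tri tri′ (λ _ → leaves i≢j _) (λ _ → leaves i≢j _) (λ eq → ⊥-elim (clash (digits {k} {R} {R′} x<k x′<k eq))))
      where
      clash : ¬ (R ≡ R′ × x ≡ x′)
      clash (refl , refl) = ne refl (Roundˡ-injective r r′)
      same : i ≡ j → R ≡ R′ ⊎ (2 + R ≤ R′ ⊎ 2 + R′ ≤ R) → Apart (k + k) δ (starDist (suc i) (suc j)) _ _
      same refl (inj₁ refl) with <-cmp x x′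
      ... | tri< lt _ _   = inj₁ (sep-rise (+-monoʳ-< (R * k) lt) ≤-refl lt tri′)
      ... | tri≈ _ refl _ = ⊥-elim (ne refl refl)
      ... | tri> _ _ gt   = inj₂ (sep-rise (+-monoʳ-< (R * k) gt) ≤-refl gt tri)
      same refl (inj₂ (inj₁ lt)) = inj₁ (sep-far 2≤k+k (round-far 2≤k lt x<k) ≤-refl tri)
      same refl (inj₂ (inj₂ lt)) = inj₂ (sep-far 2≤k+k (round-far 2≤k lt x′<k) ≤-refl tri′)
    leaf-leaf (left x<k r) (right x′<k r′) ne tri tri′ = leaf-leafˡʳ x<k r x′<k r′ tri tri′
    leaf-leaf {i = i} {j} {σ} {τ} (right x<k r) (left x′<k r′) ne tri tri′ =
      subst (λ s → Apart (k + k) δ s σ τ) (starDist-sym (suc j) (suc i)) (Sum.swap (leaf-leafˡʳ x′<k r′ x<k r tri′ tri))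
    leaf-leaf {i = i} {j} (right {x} {R = R} x<k r) (right {x′} {R = R′} x′<k r′) ne tri tri′ = by-leaf i j
      (λ eq → same eq (<-cmp x x′))
      (λ i≢j → apart-cmp tri tri′ (λ _ → leaves i≢j _) (λ _ → leaves i≢j _) (λ eq → ⊥-elim (clash (digits {k} {R} {R′} x<k x′<k eq))))
      where
      clash : ¬ (R ≡ R′ × x ≡ x′)
      clash (refl , refl) = ne refl (Roundʳ-injective r r′)
      same : i ≡ j → _ → Apart (k + k) δ (starDist (suc i) (suc j)) _ _
      same refl cmp with Roundʳ-functional r r′
      same refl (tri< lt _ _)   | refl = inj₁ (sep-rise (+-monoʳ-< (R * k) lt) ≤-refl (+-monoʳ-< k lt) tri′)
      same refl (tri≈ _ refl _) | refl = ⊥-elim (ne refl refl)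
      same refl (tri> _ _ gt)   | refl = inj₂ (sep-rise (+-monoʳ-< (R * k) gt) ≤-refl (+-monoʳ-< k gt) tri)

    apart : ∀ {y y′ a b σ τ} → At y a σ → At y′ b τ → (y ≡ y′ → a ≢ b) →
      row σ ≤ row τ + δ → row τ ≤ row σ + δ → Apart (k + k) δ (starDist a b) σ τ
    apart (centre p) (centre q) ne tri tri′ = centre-centre p q (λ eq → ne eq refl) tri tri′
    apart (centre p) final      ne tri tri′ = inj₁ (centre-final p tri)
    apart (centre p) (leaf q)   ne tri tri′ = inj₁ (centre-leaf p q tri tri′)
    apart final      (centre q) ne tri tri′ = inj₂ (centre-final q tri′)
    apart final      final      ne tri tri′ = ⊥-elim (ne refl refl)
    apart final      (leaf q)   ne tri tri′ = inj₂ (leaf-final q tri′ tri)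
    apart (leaf p)   (centre q) ne tri tri′ = inj₂ (centre-leaf q p tri′ tri)
    apart (leaf p)   final      ne tri tri′ = inj₁ (leaf-final p tri tri′)
    apart (leaf p)   (leaf q)   ne tri tri′ = leaf-leaf p q (λ eq i≡j → ne eq (cong suc i≡j)) tri tri′

  row-At : ∀ {y a σ} → At y a σ → row σ ≡ y
  row-At (centre (left _ _))    = refl
  row-At (centre (right _ _ _)) = refl
  row-At final                  = refl
  row-At (leaf (left _ _))      = refl
  row-At (leaf (right _ _))     = refl

  slot : ∀ y a → y < k + k → a ≤ n → ∃ (At y a)
  slot y a y<m a≤n with y <? k
  slot y zero y<m a≤n | yes y<k = _ , centre (left (m+[n∸m]≡n (<⇒≤ y<k)) (m<n⇒0<n∸m y<k))
  slot zero (suc zero) y<m a≤n | yes y<k = _ , leaf (left y<k wrap)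
  slot zero (suc (suc i)) y<m a≤n | yes y<k = _ , leaf (left y<k (outer a≤n))
  slot (suc y) (suc i) y<m a≤n | yes y<k = _ , leaf (left y<k (inner a≤n))
  slot y a y<m a≤n | no y≮k with m≤n⇒∃[o]m+o≡n (≮⇒≥ y≮k)
  slot _ zero y<m a≤n | no _ | zero , refl = subst (λ y → ∃ (At y 0)) (sym (+-identityʳ k)) (_ , final)
  slot _ zero y<m a≤n | no _ | suc x , refl = _ , centre (right (s≤s z≤n) (m+[n∸m]≡n (<⇒≤ x<k)) (m<n⇒0<n∸m x<k))
    where
    x<k : suc x < k
    x<k = +-cancelˡ-< k _ k y<m
  slot _ (suc i) y<m a≤n | no _ | x , refl with m≤n⇒m<n∨m≡n a≤n
  ... | inj₁ lt = _ , leaf (right (+-cancelˡ-< k x k y<m) (step lt))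
  ... | inj₂ eq = _ , leaf (right (+-cancelˡ-< k x k y<m) (wrap eq))

  -- The centre vertex of row k - 1, opening the descending round; the argument stands for k - 1 to
  -- avoid truncated subtraction.
  start : ℕ → Slot
  start j = ⟨ 1 , j , 4 ⟩

  At-start : ∀ {j y σ} → y ≡ j → suc j ≡ k → At y 0 σ → σ ≡ start j
  At-start {j} refl eq (centre (left {t = t} p _)) with refl ← +-cancelˡ-≡ j t 1 (trans p (trans (sym eq) (+-comm 1 j))) = refl
  At-start refl eq (centre (right {x} _ _ _)) = ⊥-elim (<⇒≱ (≤-reflexive eq) (m≤m+n k x))
  At-start refl eq final = ⊥-elim (1+n≢n eq)

  At-end : ∀ {y σ} → y ≡ k → At y 0 σ → σ ≡ end
  At-end {y} eq (centre (left {t = t} p 0<t)) = ⊥-elim (<⇒≢ (m<m+n y 0<t) (trans eq (sym p)))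
  At-end eq (centre (right 0<x _ _)) = ⊥-elim (<⇒≢ (m<m+n k 0<x) (sym eq))
  At-end eq final = refl

  private
    above : ∀ {j t z φ} → suc j ≡ k → (1 < t ⊎ (1 ≤ t × j ≤ z)) → 4 ≤ φ → label (k + k) (start j) ≤ label (k + k) ⟨ t , z , φ ⟩
    above refl (inj₁ lt) le = label-mono lt (≤-trans (n≤1+n _) (m≤m+n _ _)) le
    above refl (inj₂ (le , le′)) le″ = +-mono-≤ (+-mono-≤ (*-monoˡ-≤ (k + k) le) le′) le″

    below : ∀ {t z φ} → z ≤ k + k → (t < suc n * k ⊎ (t ≤ suc n * k × z ≤ k)) → φ ≤ 4 * k + 2 →
      label (k + k) ⟨ t , z , φ ⟩ ≤ label (k + k) end
    below z≤m (inj₁ lt) le = label-mono lt z≤m le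
    below z≤m (inj₂ (le , le′)) le″ = +-mono-≤ (+-mono-≤ (*-monoˡ-≤ (k + k) le) le′) le″

    4≤4* : ∀ {t} → 0 < t → 4 ≤ 4 * t
    4≤4* = *-monoʳ-≤ 4

    4≤φ : 4 ≤ 4 * k + 1
    4≤φ = ≤-trans (4≤4* 0<k) (m≤m+n _ 1)

  start≤ : ∀ {j y a σ} → suc j ≡ k → At y a σ → label (k + k) (start j) ≤ label (k + k) σ
  start≤ eq (centre (left {x} {1} p _)) = above eq (inj₂ (≤-refl , ≤-reflexive (suc-injective (trans eq (trans (sym p) (+-comm x 1)))))) ≤-refl
  start≤ eq (centre (left {t = suc (suc t)} _ _)) = above {t = suc (suc t)} eq (inj₁ (s≤s (s≤s z≤n))) (4≤4* {suc (suc t)} (s≤s z≤n))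
  start≤ eq (centre (right {x} {t} _ _ 0<t)) =
    above eq (inj₂ (0<t , ≤-trans (n≤1+n _) (≤-trans (≤-reflexive eq) (m≤m+n k x)))) (≤-trans (4≤4* 0<t) (m≤m+n _ 2))
  start≤ eq final = above eq (inj₁ (≤-<-trans 0<k k<end)) (≤-trans (4≤4* 0<k) (m≤m+n _ 2))
  start≤ eq (leaf (left _ r)) = above eq (inj₁ (≤-<-trans 0<k (leafˡ-late r))) 4≤φ
  start≤ eq (leaf (right {x} _ r)) = above eq (inj₁ (≤-trans 2≤k (leafʳ-late {x} r))) 4≤φ

  ≤end : ∀ {y a σ} → y < k + k → At y a σ → label (k + k) σ ≤ label (k + k) end
  ≤end y<m (centre (left {x} {t} p _)) = below {t} (<⇒≤ y<m) (inj₁ (≤-<-trans (t≤k x p) k<end))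
    (≤-trans (*-monoʳ-≤ 4 (t≤k x p)) (m≤m+n _ 2))
  ≤end y<m (centre (right {x} {t} 0<x p _)) = below (<⇒≤ y<m) (inj₁ (≤-<-trans (t≤k x p) k<end))
    (+-monoˡ-≤ 2 (*-monoʳ-≤ 4 (t≤k x p)))
  ≤end y<m final = ≤-refl
  ≤end y<m (leaf (left {x} x<k (inner {i = i} i<n))) = below (<⇒≤ y<m) (inj₁ (before-end {x} {suc i} (s≤s i<n) x<k)) φ≤
    where φ≤ = +-monoʳ-≤ (4 * k) (s≤s z≤n)
  ≤end y<m (leaf (left x<k (outer {i} i<n))) = below (<⇒≤ y<m) (inj₁ (before-end {0} {2 + i} (s≤s i<n) x<k)) φ≤
    where φ≤ = +-monoʳ-≤ (4 * k) (s≤s z≤n)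
  ≤end y<m (leaf (left x<k wrap)) = below (<⇒≤ y<m) (inj₂ (≤-reflexive (+-identityʳ _) , z≤n)) (+-monoʳ-≤ (4 * k) (s≤s z≤n))
  ≤end y<m (leaf (right {x} x<k r)) = below (<⇒≤ y<m) (inj₁ (leafʳ-early x<k r)) (+-monoʳ-≤ (4 * k) (s≤s z≤n))

  open Product (k + k) n

  vertex-slot : ∀ (u : V G) → ∃ (At (toℕ (proj₁ u)) (toℕ (proj₂ u)))
  vertex-slot (i , a) = slot (toℕ i) (toℕ a) (toℕ<n i) (toℕ≤pred[n] a)

  labeling : V G → ℕ
  labeling u = label (k + k) (proj₁ (vertex-slot u))

  separated : ∀ u v → u ≢ v → k + k + 2 ≤ ∣ labeling u - labeling v ∣ + dist u v
  separated u@(i , a) v@(j , b) u≢v with vertex-slot u | vertex-slot v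
  ... | σ , p | τ , q = Apart⇒∣-∣ {σ = σ} {τ} (apart p q
    (λ i≡j a≡b → u≢v (cong₂ _,_ (toℕ-injective i≡j) (toℕ-injective a≡b)))
    (subst₂ (λ y z → y ≤ z + ∣ toℕ i - toℕ j ∣) (sym (row-At p)) (sym (row-At q)) (m≤n+∣m-n∣ (toℕ i) (toℕ j)))
    (subst₂ (λ y z → z ≤ y + ∣ toℕ i - toℕ j ∣) (sym (row-At p)) (sym (row-At q)) (m≤n+∣n-m∣ (toℕ j) (toℕ i))))

theorem-even : ∀ k n → 2 ≤ k → 3 ≤ n → IsRadioNumber (P (k + k) □ K1 n) ⌊ ((k + k) * (k + k) * (n + 1) + 2 * (k + k ∸ 1)) /2⌋
theorem-even k@(suc j) n 2≤k 3≤n = radioNumber (k + k) n (≤-trans (n≤1+n 3) (+-mono-≤ 2≤k 2≤k)) 3≤n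
  labeling first last separated bounds r width tight
  where
  open Even k n 2≤k 3≤n
  open Product (k + k) n
  j<m : j < k + k
  j<m = m≤m+n k k
  k<m : k < k + k
  k<m = m<m+n k 0<k
  -- The centre vertices of the two middle rows: adjacent and of weight 1 each, as equality in the
  -- lower bound demands.
  first last : V G
  first = fromℕ< j<m , Fin.zero
  last  = fromℕ< k<m , Fin.zero
  label-first : labeling first ≡ label (k + k) (start j)
  label-first = cong (label (k + k)) (At-start (toℕ-fromℕ< j<m) refl (proj₂ (vertex-slot first)))
  label-last : labeling last ≡ label (k + k) end
  label-last = cong (label (k + k)) (At-end (toℕ-fromℕ< k<m) (proj₂ (vertex-slot last)))
  bounds : ∀ w → labeling first ≤ labeling w × labeling w ≤ labeling last
  bounds w = ≤-trans (≤-reflexive label-first) (start≤ refl (proj₂ (vertex-slot w)))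
           , ≤-trans (≤end (toℕ<n (proj₁ w)) (proj₂ (vertex-slot w))) (≤-reflexive (sym label-last))
  -- The numerator is exactly twice this, so the floor loses nothing.
  half : ℕ
  half = (k + k) * k * (n + 1) + (j + k)
  r : ℕ
  r = ⌊ ((k + k) * (k + k) * (n + 1) + 2 * (k + k ∸ 1)) /2⌋
  r≡half : r ≡ half
  r≡half = trans (cong ⌊_/2⌋ (double k j n)) (sym (n≡⌊n+n/2⌋ half))
    where
    double : ∀ k j n → (k + k) * (k + k) * (n + 1) + 2 * (j + k) ≡ (k + k) * k * (n + 1) + (j + k) + ((k + k) * k * (n + 1) + (j + k))
    double = solve-∀
  width : labeling last ≡ labeling first + r
  width = trans label-last (trans (eq j n) (sym (cong₂ _+_ label-first r≡half)))
    where
    eq : ∀ j n → suc n * suc j * (suc j + suc j) + suc j + (4 * suc j + 2) ≡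
      1 * (suc j + suc j) + j + 4 + ((suc j + suc j) * suc j * (n + 1) + (j + suc j))
    eq = solve-∀
  tight : r + totalWeight (k + k) n + (k + k + 2) ≡ (k + k + 2) * ((k + k) * suc n) + 1
  tight = trans (cong₂ (λ a b → a + (suc n * b + (k + k) * (2 * n)) + (k + k + 2)) r≡half (rowWeights-even k)) (eq j n)
    where
    eq : ∀ j n → (suc j + suc j) * suc j * (n + 1) + (j + suc j) + (suc n * (2 * (suc j * suc j)) + (suc j + suc j) * (2 * n)) + (suc j + suc j + 2) ≡
      (suc j + suc j + 2) * ((suc j + suc j) * suc n) + 1
    eq = solve-∀

-- Odd m ≥ 5

-- Here m = 2k + 1 and M = m + 1: rows k, …, 2k are renumbered K, …, K + k, as if row k were the first
-- of the right half of a path with 2K rows, so that opposite rows are one closer than their numbers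
-- say.  The middle row sits between row 0 and row 2k in every round except once, where the step goes
-- directly from (0 , 0) to (2k , 0); both must then lie over the star centre, which is what makes the
-- entries `top`, `turnˡ` and `turnʳ` of `Centre` irregular.
module Odd (j n : ℕ) (3≤n : 3 ≤ n) where

  k K : ℕ
  k = 2 + j
  K = suc k

  -- Round 0 occupies times 1 to k and round R ≥ 1 begins at (R + 1) k; the gap up to 2 k - 1 makes
  -- room for the round of centre vertices.
  roundTime : ℕ → ℕ → ℕ
  roundTime zero    x = suc x
  roundTime (suc R) x = (2 + R) * k + x

  -- Each passage from the middle row to row 2k costs one unit, as both have numbers in the right
  -- half: h marks it within the round and R accumulates it. The constant 4 k + 4 is one more than
  -- the delay 4 j + 11 of the last centre vertex.
  phase : ℕ → ℕ → ℕ
  phase zero    h = suc h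
  phase (suc R) h = 4 * k + 4 + R + h

  -- The order of rows is j, k + j, ..., 1, k + 1, 0, 2k, k - 1, 2k - 1. The time of `top` is one
  -- below that of row 0, yet its label is 3 larger: its row number is M - 1 and its delay 4 higher.
  data Centre : (y : ℕ) → Slot → Set where
    left   : ∀ {x i} → x + i ≡ j → Centre x ⟨ K + i , x , 4 * i + 3 ⟩
    right  : ∀ {x i} → 0 < x → x + i ≡ j → Centre (k + x) ⟨ K + i , K + x , 4 * i + 5 ⟩
    top    : Centre (k + k) ⟨ k + j , K + k , 4 * j + 7 ⟩
    turnˡ  : Centre (suc j) ⟨ K + j , suc j , 4 * j + 9 ⟩
    turnʳ  : Centre (k + suc j) ⟨ K + j , K + suc j , 4 * j + 11 ⟩

  -- Modulo n, round R has leaf R in rows 0 to k - 1, leaf R - 1 in rows k to 2k - 1 and leaf R + 1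
  -- in row 2k, distinct as n ≥ 3. Round 0 omits rows 0 and k, and round n consists of them.
  data Roundᵇ : (i R : ℕ) → Set where
    step : ∀ {i} → suc i < n → Roundᵇ (suc i) (suc i)
    wrap : ∀ {R} → R ≡ n → Roundᵇ 0 R

  data Roundʳ : (i R : ℕ) → Set where
    step : ∀ {i} → suc i < n → Roundʳ i (suc i)
    wrap : ∀ {i} → suc i ≡ n → Roundʳ i 0

  data Roundᵗ : (i R : ℕ) → Set where
    step : ∀ {i} → suc i < n → Roundᵗ (suc i) i
    wrap : ∀ {R} → suc R ≡ n → Roundᵗ 0 R

  -- h is the extra delay of one, within a round, of every row but 0 and the middle one.
  data Leaf : (y i R x z h : ℕ) → Set where
    bottom : ∀ {i R} → Roundᵇ i R → Leaf 0 i R 0 0 0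
    left   : ∀ {x i} → 0 < x → x < k → i < n → Leaf x i i x x 1
    hub    : ∀ {i} → i < n → Leaf k i (suc i) 0 K 0
    right  : ∀ {x i R} → 0 < x → x < k → Roundʳ i R → Leaf (k + x) i R x (K + x) 1
    top    : ∀ {i R} → Roundᵗ i R → Leaf (k + k) i R 0 (K + k) 1

  start : Slot
  start = ⟨ 1 , K , 0 ⟩

  data At : (y a : ℕ) → Slot → Set where
    hub    : At k 0 start
    centre : ∀ {y σ} → Centre y σ → At y 0 σ
    leaf   : ∀ {y i R x z h} → Leaf y i R x z h → At y (suc i) ⟨ roundTime R x , z , phase R h ⟩

  0<k : 0 < k
  0<k = s≤s z≤n

  2≤k : 2 ≤ k
  2≤k = s≤s (s≤s z≤n)

  2≤M : 2 ≤ K + K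
  2≤M = s≤s (s≤s z≤n)

  x<k : ∀ {y i R x z h} → Leaf y i R x z h → x < k
  x<k (bottom _)      = 0<k
  x<k (left _ lt _)   = lt
  x<k (hub _)         = 0<k
  x<k (right _ lt _)  = lt
  x<k (top _)         = 0<k

  h≤1 : ∀ {y i R x z h} → Leaf y i R x z h → h ≤ 1
  h≤1 (bottom _)    = z≤n
  h≤1 (left _ _ _)  = ≤-refl
  h≤1 (hub _)       = z≤n
  h≤1 (right _ _ _) = ≤-refl
  h≤1 (top _)       = ≤-refl

  0<x⇒h≡1 : ∀ {y i R x z h} → Leaf y i R x z h → 0 < x → h ≡ 1
  0<x⇒h≡1 (left _ _ _)  _ = refl
  0<x⇒h≡1 (right _ _ _) _ = refl

  time-gap : ∀ {R R′ x} x′ → R < R′ → roundTime R x + k ≤ roundTime R′ x′ + x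
  time-gap {zero} {suc R′} {x} x′ _ = linear 0<k (R′ * k + x′) (eq k R′ x x′)
    where
    eq : ∀ k R′ x x′ → suc x + k + k + (R′ * k + x′) ≡ (2 + R′) * k + x′ + x + 1
    eq = solve-∀
  time-gap {suc R} {suc R′} {x} x′ (s≤s lt) = linear (*-monoˡ-≤ k lt) x′ (eq k R R′ x x′)
    where
    eq : ∀ k R R′ x x′ → (2 + R) * k + x + k + R′ * k + x′ ≡ (2 + R′) * k + x′ + x + suc R * k
    eq = solve-∀

  time-< : ∀ {R R′ x} x′ → R < R′ → x < k → roundTime R x < roundTime R′ x′
  time-< {R} {R′} {x} x′ lt x<k = +-cancelʳ-< x _ _ (<-≤-trans (+-monoʳ-< (roundTime R x) x<k) (time-gap x′ lt))

  -- Rows 0, k and 2k open their round, so at least k ≥ 2 time units pass before anything in a later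
  -- round.
  time-wide : ∀ {R R′} x′ → R < R′ → 2 + roundTime R 0 ≤ roundTime R′ x′
  time-wide {R} {R′} x′ lt = ≤-trans (≤-trans (≤-reflexive (+-comm 2 (roundTime R 0))) (+-monoʳ-≤ (roundTime R 0) 2≤k))
    (≤-trans (time-gap x′ lt) (≤-reflexive (+-identityʳ _)))

  time-far : ∀ {R R′ x} x′ → 2 + R ≤ R′ → x < k → 2 + roundTime R x ≤ roundTime R′ x′
  time-far {R} {R′} {x} x′ lt x<k = ≤-trans (s≤s (time-< {R} {suc R} 0 ≤-refl x<k)) (time-< x′ lt 0<k)

  time-x< : ∀ R {x x′} → x < x′ → roundTime R x < roundTime R x′
  time-x< zero    lt = s≤s lt
  time-x< (suc R) lt = +-monoʳ-< ((2 + R) * k) lt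

  time-x-injective : ∀ R {x x′} → roundTime R x ≡ roundTime R x′ → x ≡ x′
  time-x-injective zero    eq = suc-injective eq
  time-x-injective (suc R) eq = +-cancelˡ-≡ ((2 + R) * k) _ _ eq

  phase-< : ∀ {R R′ h} h′ → h ≤ 1 → R < R′ → phase R h ≤ phase R′ h′
  phase-< {zero} {suc R′} {h} h′ h≤1 _ = ≤-trans (s≤s h≤1) (≤-trans (s≤s (s≤s z≤n)) (≤-trans (m≤n+m 4 (4 * k)) (≤-trans (m≤m+n (4 * k + 4) R′) (m≤m+n _ h′))))
  phase-< {suc R} {suc R′} {h} h′ h≤1 (s≤s lt) = linear (+-mono-≤ h≤1 lt) h′ (eq k R R′ h h′)
    where
    eq : ∀ k R R′ h h′ → 4 * k + 4 + R + h + (1 + R′) + h′ ≡ 4 * k + 4 + R′ + h′ + (h + suc R)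
    eq = solve-∀

  phase-h : ∀ R {h h′} → h ≤ h′ → phase R h ≤ phase R h′
  phase-h zero    le = s≤s le
  phase-h (suc R) le = +-monoʳ-≤ (4 * k + 4 + R) le

  module _ {y y′ i i′ R R′ x x′ z z′ h h′} (p : Leaf y i R x z h) (q : Leaf y′ i′ R′ x′ z′ h′) where

    -- Within a round the unit h is acquired on leaving x = 0; in the next round it has turned into
    -- an increase of R.
    phase-mono : roundTime R x < roundTime R′ x′ → phase R h ≤ phase R′ h′
    phase-mono lt with <-cmp R R′
    ... | tri< R<R′ _ _ = phase-< h′ (h≤1 p) R<R′
    ... | tri> _ _ R>R′ = ⊥-elim (<-asym lt (time-< x R>R′ (x<k q)))
    ... | tri≈ _ refl _ with <-cmp x x′
    ...   | tri< x<x′ _ _ = phase-h R (≤-trans (h≤1 p) (≤-reflexive (sym (0<x⇒h≡1 q (≤-<-trans z≤n x<x′)))))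
    ...   | tri≈ _ refl _ = ⊥-elim (<-irrefl refl lt)
    ...   | tri> _ _ x>x′ = ⊥-elim (<-asym lt (time-x< R x>x′))

    time-injective : roundTime R x ≡ roundTime R′ x′ → R ≡ R′ × x ≡ x′
    time-injective eq with <-cmp R R′
    ... | tri< lt _ _   = ⊥-elim (<⇒≢ (time-< x′ lt (x<k p)) eq)
    ... | tri> _ _ gt   = ⊥-elim (<⇒≢ (time-< x gt (x<k q)) (sym eq))
    ... | tri≈ _ refl _ = refl , time-x-injective R eq

    module _ {δ s : ℕ} where

      leaf-rise : R < R′ → z < z′ → z′ ≤ z + δ → Sep (K + K) δ s ⟨ roundTime R x , z , phase R h ⟩ ⟨ roundTime R′ x′ , z′ , phase R′ h′ ⟩
      leaf-rise lt = sep-rise (time-< x′ lt (x<k p)) (phase-< h′ (h≤1 p) lt)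

      leaf-far : 2 + R ≤ R′ → z ≤ z′ + δ → Sep (K + K) δ s ⟨ roundTime R x , z , phase R h ⟩ ⟨ roundTime R′ x′ , z′ , phase R′ h′ ⟩
      leaf-far lt = sep-far 2≤M (time-far x′ lt (x<k p)) (phase-< h′ (h≤1 p) (≤-trans (n≤1+n _) lt))

      leaf-wide : x ≡ 0 → R < R′ → z ≤ z′ + δ → Sep (K + K) δ s ⟨ roundTime R x , z , phase R h ⟩ ⟨ roundTime R′ x′ , z′ , phase R′ h′ ⟩
      leaf-wide refl lt = sep-far 2≤M (time-wide {R} x′ lt) (phase-< h′ (h≤1 p) lt)

      leaf-same : R ≡ R′ → x < x′ → z < z′ → z′ ≤ z + δ → Sep (K + K) δ s ⟨ roundTime R x , z , phase R h ⟩ ⟨ roundTime R′ x′ , z′ , phase R′ h′ ⟩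
      leaf-same refl lt = sep-rise (time-x< R lt) (phase-mono (time-x< R lt))

  Roundᵇ-injective : ∀ {i i′ R} → Roundᵇ i R → Roundᵇ i′ R → i ≡ i′
  Roundᵇ-injective (step _)    (step _)    = refl
  Roundᵇ-injective (step lt)   (wrap refl) = ⊥-elim (<-irrefl refl lt)
  Roundᵇ-injective (wrap refl) (step lt)   = ⊥-elim (<-irrefl refl lt)
  Roundᵇ-injective (wrap _)    (wrap _)    = refl

  Roundʳ-injective : ∀ {i i′ R} → Roundʳ i R → Roundʳ i′ R → i ≡ i′
  Roundʳ-injective (step _)  (step _)   = refl
  Roundʳ-injective (wrap eq) (wrap eq′) = suc-injective (trans eq (sym eq′))

  Roundʳ-functional : ∀ {i R R′} → Roundʳ i R → Roundʳ i R′ → R ≡ R′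
  Roundʳ-functional (step _)  (step _)  = refl
  Roundʳ-functional (step lt) (wrap eq) = ⊥-elim (<⇒≢ lt eq)
  Roundʳ-functional (wrap eq) (step lt) = ⊥-elim (<⇒≢ lt eq)
  Roundʳ-functional (wrap _)  (wrap _)  = refl

  Roundᵗ-injective : ∀ {i i′ R} → Roundᵗ i R → Roundᵗ i′ R → i ≡ i′
  Roundᵗ-injective (step _)  (step _)  = refl
  Roundᵗ-injective (step lt) (wrap eq) = ⊥-elim (<⇒≢ lt eq)
  Roundᵗ-injective (wrap eq) (step lt) = ⊥-elim (<⇒≢ lt eq)
  Roundᵗ-injective (wrap _)  (wrap _)  = refl

  module _ {δ : ℕ} where

    -- Throughout, δ is one more than the distance of the rows, since renumbering widens opposite
    -- rows by one. Rows on one side keep that unit to spare, which the strict hypothesis records.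
    same-time : ∀ {y y′ i i′ R x z z′ h h′} → Leaf y i R x z h → Leaf y′ i′ R x z′ h′ → i ≢ i′ → ∣ y - y′ ∣ < δ →
      z ≤ z′ + δ → z′ ≤ z + δ → Apart (K + K) δ 2 ⟨ roundTime R x , z , phase R h ⟩ ⟨ roundTime R x , z′ , phase R h′ ⟩
    private
      -- The numbers differ by k only, one short of a pair; the spare unit of δ and the unit h close
      -- the gap.
      hub-top : ∀ {R} → ∣ k - (k + k) ∣ < δ →
        Sep (K + K) δ 2 ⟨ roundTime (suc R) 0 , K , phase (suc R) 0 ⟩ ⟨ roundTime (suc R) 0 , K + k , phase (suc R) 1 ⟩
      hub-top {R} lt = sep-span k 1 ≤-refl ≤-refl (≤-reflexive (eq j (4 * k + 4 + R)))
        (≤-trans (≤-reflexive (+-assoc K k 1)) (+-monoʳ-≤ K (≤-trans (≤-reflexive (trans (+-comm k 1) (cong suc (sym (∣m-m+n∣≡n k k))))) lt)))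
        where
        eq : ∀ j φ → φ + 0 + (3 + j + (3 + j) + 2) ≡ φ + 1 + 2 + (2 * (2 + j) + 1)
        eq = solve-∀

      pair : ∀ {t φ x z φ′} → x + K ≤ z → φ ≤ φ′ → z ≤ x + δ → Sep (K + K) δ 2 ⟨ t , x , φ ⟩ ⟨ t , z , φ′ ⟩
      pair le le′ tri = sep-pair ≤-refl le (+-monoˡ-≤ 2 le′) tri

    same-time (bottom r)   (bottom r′)    ne _ _   _    = ⊥-elim (ne (Roundᵇ-injective r r′))
    same-time (bottom r)   (left () _ _)
    same-time (bottom r)   (hub _)        ne _ _   tri′ = inj₁ (pair ≤-refl ≤-refl tri′)
    same-time (bottom r)   (right () _ _)
    same-time {R = R} (bottom r) (top r′) ne _ _   tri′ = inj₁ (pair (m≤m+n K k) (phase-h R z≤n) tri′)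
    same-time (left () _ _) (bottom r)
    same-time (left _ _ _) (left _ _ _)   ne _ _   _    = ⊥-elim (ne refl)
    same-time (left () _ _) (hub _)
    same-time {x = x} (left _ _ _) (right _ _ _) ne _ _ tri′ = inj₁ (pair (≤-reflexive (+-comm x K)) ≤-refl tri′)
    same-time (left () _ _) (top r)
    same-time (hub _)      (bottom r)     ne _ tri _    = inj₂ (pair ≤-refl ≤-refl tri)
    same-time (hub _)      (left () _ _)
    same-time (hub _)      (hub _)        ne _ _   _    = ⊥-elim (ne refl)
    same-time (hub _)      (right () _ _)
    same-time (hub _)      (top _)        ne lt _  _    = inj₁ (hub-top lt)
    same-time (right () _ _) (bottom r)
    same-time {x = x} (right _ _ _) (left _ _ _) ne _ tri _ = inj₂ (pair (≤-reflexive (+-comm x K)) ≤-refl tri)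
    same-time (right () _ _) (hub _)
    same-time (right _ _ r) (right _ _ r′) ne _ _  _    = ⊥-elim (ne (Roundʳ-injective r r′))
    same-time (right () _ _) (top r)
    same-time {R = R} (top r) (bottom r′) ne _ tri _    = inj₂ (pair (m≤m+n K k) (phase-h R z≤n) tri)
    same-time (top r)      (left () _ _)
    same-time (top _)      (hub _)        ne lt _  _    = inj₂ (hub-top (subst (_< δ) (∣-∣-comm (k + k) k) lt))
    same-time (top r)      (right () _ _)
    same-time (top r)      (top r′)       ne _ _   _    = ⊥-elim (ne (Roundᵗ-injective r r′))

    module _ {s : ℕ} where

      Leaves : (R x z h R′ x′ z′ h′ : ℕ) → Set
      Leaves R x z h R′ x′ z′ h′ =
        Apart (K + K) δ s ⟨ roundTime R x , z , phase R h ⟩ ⟨ roundTime R′ x′ , z′ , phase R′ h′ ⟩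

      from-bottom : ∀ {y i R R′ x′ z′ h′} → Roundᵇ i R → Leaf y i R′ x′ z′ h′ → 0 ≢ y →
        0 ≤ z′ + δ → z′ ≤ 0 + δ → Leaves R 0 0 0 R′ x′ z′ h′
      from-bottom b            (bottom _)                     ne tri tri′ = ⊥-elim (ne refl)
      from-bottom b@(step _)   q@(left 0<x _ _)               ne tri tri′ = inj₁ (leaf-same (bottom b) q refl 0<x 0<x tri′)
      from-bottom b@(wrap refl) q@(left _ _ _)                ne tri tri′ = inj₂ (leaf-far q (bottom b) (≤-trans (s≤s (s≤s z≤n)) 3≤n) tri′)
      from-bottom b@(step _)   q@(hub _)                      ne tri tri′ = inj₁ (leaf-rise (bottom b) q ≤-refl (s≤s z≤n) tri′)
      from-bottom b@(wrap refl) q@(hub _)                     ne tri tri′ = inj₂ (leaf-far q (bottom b) 3≤n tri′)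
      from-bottom b@(step _)   q@(right _ _ (step _))         ne tri tri′ = inj₁ (leaf-rise (bottom b) q ≤-refl (s≤s z≤n) tri′)
      from-bottom b@(step _)   q@(right _ _ (wrap eq))        ne tri tri′ = inj₂ (leaf-far q (bottom b) (s≤s⁻¹ (≤-trans 3≤n (≤-reflexive (sym eq)))) tri′)
      from-bottom b@(wrap refl) q@(right _ _ (step _))        ne tri tri′ = inj₂ (leaf-far q (bottom b) 3≤n tri′)
      from-bottom b@(wrap refl) (right _ _ (wrap refl))       ne tri tri′ = ⊥-elim (<⇒≱ 3≤n (s≤s z≤n))
      from-bottom b@(step _)   q@(top (step _))               ne tri tri′ = inj₂ (leaf-wide q (bottom b) refl ≤-refl tri′)
      from-bottom b@(wrap refl) q@(top (wrap eq))             ne tri tri′ = inj₂ (leaf-wide q (bottom b) refl (≤-reflexive eq) tri′)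

      from-left : ∀ {y i R x R′ x′ z′ h′} → (p : Leaf x i R x x 1) → 0 < x → R ≡ i → x < k → Leaf y i R′ x′ z′ h′ → x ≢ y →
        x ≤ z′ + δ → z′ ≤ x + δ → Leaves R x x 1 R′ x′ z′ h′
      from-left p _ refl _ (bottom b) ne tri tri′ = Sum.swap (from-bottom b p (ne ∘ sym) tri′ tri)
      from-left {x = x} p _ refl _ q@(left {x′} _ _ _) ne tri tri′ with <-cmp x x′
      ... | tri< lt _ _ = inj₁ (leaf-same p q refl lt lt tri′)
      ... | tri≈ _ eq _ = ⊥-elim (ne eq)
      ... | tri> _ _ gt = inj₂ (leaf-same q p refl gt gt tri)
      from-left p _ refl x<k q@(hub _) ne tri tri′ = inj₁ (leaf-rise p q ≤-refl (m<n⇒m<1+n x<k) tri′)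
      from-left p _ refl x<k q@(right _ _ (step _)) ne tri tri′ = inj₁ (leaf-rise p q ≤-refl (<-≤-trans (m<n⇒m<1+n x<k) (m≤m+n K _)) tri′)
      from-left p _ refl x<k q@(right _ _ (wrap eq)) ne tri tri′ = inj₂ (leaf-far q p (s≤s⁻¹ (≤-trans 3≤n (≤-reflexive (sym eq)))) tri′)
      from-left p _ refl x<k q@(top (step _)) ne tri tri′ = inj₂ (leaf-wide q p refl ≤-refl tri′)
      from-left p _ refl x<k q@(top (wrap eq)) ne tri tri′ = inj₁ (leaf-far p q (s≤s⁻¹ (≤-trans 3≤n (≤-reflexive (sym eq)))) tri)

      from-hub : ∀ {y i R′ x′ z′ h′} → i < n → Leaf y i R′ x′ z′ h′ → k ≢ y →
        K ≤ z′ + δ → z′ ≤ K + δ → Leaves (suc i) 0 K 0 R′ x′ z′ h′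
      from-hub i<n (bottom b) ne tri tri′ = Sum.swap (from-bottom b (hub i<n) (λ ()) tri′ tri)
      from-hub i<n p@(left 0<x x<k _) ne tri tri′ = Sum.swap (from-left p 0<x refl x<k (hub i<n) (ne ∘ sym) tri′ tri)
      from-hub i<n (hub _) ne tri tri′ = ⊥-elim (ne refl)
      from-hub i<n q@(right 0<x _ (step _)) ne tri tri′ = inj₁ (leaf-same (hub i<n) q refl 0<x (m<m+n K 0<x) tri′)
      from-hub i<n q@(right _ _ (wrap eq)) ne tri tri′ = inj₂ (leaf-far q (hub i<n) (≤-trans (≤-trans (n≤1+n 2) 3≤n) (≤-reflexive (sym eq))) tri′)
      from-hub i<n q@(top (step _)) ne tri tri′ = inj₂ (leaf-far q (hub i<n) ≤-refl tri′)
      from-hub i<n q@(top (wrap eq)) ne tri tri′ = inj₁ (leaf-rise (hub i<n) q (s≤s⁻¹ (≤-trans 3≤n (≤-reflexive (sym eq)))) (m<m+n K 0<k) tri′)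

      from-right : ∀ {y i R x R′ x′ z′ h′} → Leaf (k + x) i R x (K + x) 1 → 0 < x → x < k → Roundʳ i R → Leaf y i R′ x′ z′ h′ → k + x ≢ y →
        K + x ≤ z′ + δ → z′ ≤ K + x + δ → Leaves R x (K + x) 1 R′ x′ z′ h′
      from-right p _ _ _ (bottom b) ne tri tri′ = Sum.swap (from-bottom b p (ne ∘ sym) tri′ tri)
      from-right p _ _ _ q@(left 0<x x<k _) ne tri tri′ = Sum.swap (from-left q 0<x refl x<k p (ne ∘ sym) tri′ tri)
      from-right p _ _ _ (hub i<n) ne tri tri′ = Sum.swap (from-hub i<n p (ne ∘ sym) tri′ tri)
      from-right {x = x} p _ _ r q@(right {x′} _ _ r′) ne tri tri′ with Roundʳ-functional r r′ | <-cmp x x′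
      ... | refl | tri< lt _ _ = inj₁ (leaf-same p q refl lt (+-monoʳ-< K lt) tri′)
      ... | refl | tri≈ _ eq _ = ⊥-elim (ne (cong (k +_) eq))
      ... | refl | tri> _ _ gt = inj₂ (leaf-same q p refl gt (+-monoʳ-< K gt) tri)
      from-right p _ x<k (step _)  q@(top (step _))  ne tri tri′ = inj₂ (leaf-far q p ≤-refl tri′)
      from-right p _ x<k (step _)  q@(top (wrap eq)) ne tri tri′ =
        inj₁ (leaf-rise p q (s≤s⁻¹ (≤-trans 3≤n (≤-reflexive (sym eq)))) (+-monoʳ-< K x<k) tri′)
      from-right p _ x<k (wrap eq) q@(top (step {zero} _)) ne tri tri′ = ⊥-elim (<⇒≱ 3≤n (≤-reflexive (sym eq)))
      from-right p _ x<k (wrap eq) q@(top (step {suc i} _)) ne tri tri′ = inj₁ (leaf-rise p q (s≤s z≤n) (+-monoʳ-< K x<k) tri′)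
      from-right p _ x<k (wrap eq) q@(top (wrap _)) ne tri tri′ = ⊥-elim (<⇒≱ 3≤n (≤-trans (≤-reflexive (sym eq)) (s≤s z≤n)))

      -- Apart from wrapping, leaf i is met in row 2k in round i - 1, on the left in round i, and
      -- from the middle to row 2k - 1 in round i + 1. Neighbouring rounds thus lead to a higher row
      -- or start from x = 0; the wrapped cases fit the same criteria by n ≥ 3.
      same-leaf : ∀ {y y′ i R x z h R′ x′ z′ h′} → Leaf y i R x z h → Leaf y′ i R′ x′ z′ h′ → y ≢ y′ →
        z ≤ z′ + δ → z′ ≤ z + δ → Leaves R x z h R′ x′ z′ h′
      same-leaf (bottom b) q ne tri tri′ = from-bottom b q ne tri tri′
      same-leaf p@(left 0<x x<k _) q ne tri tri′ = from-left p 0<x refl x<k q ne tri tri′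
      same-leaf (hub i<n) q ne tri tri′ = from-hub i<n q ne tri tri′
      same-leaf p@(right 0<x x<k r) q ne tri tri′ = from-right p 0<x x<k r q ne tri tri′
      same-leaf (top _) (top _) ne tri tri′ = ⊥-elim (ne refl)
      same-leaf p@(top _) (bottom b) ne tri tri′ = Sum.swap (from-bottom b p (ne ∘ sym) tri′ tri)
      same-leaf p@(top _) q@(left 0<x x<k _) ne tri tri′ = Sum.swap (from-left q 0<x refl x<k p (ne ∘ sym) tri′ tri)
      same-leaf p@(top _) (hub i<n) ne tri tri′ = Sum.swap (from-hub i<n p (ne ∘ sym) tri′ tri)
      same-leaf p@(top _) q@(right 0<x x<k r) ne tri tri′ = Sum.swap (from-right q 0<x x<k r p (ne ∘ sym) tri′ tri)

    distinct-leaves : ∀ {y y′ i i′ R x z h R′ x′ z′ h′} → Leaf y i R x z h → Leaf y′ i′ R′ x′ z′ h′ → i ≢ i′ → ∣ y - y′ ∣ < δ →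
      z ≤ z′ + δ → z′ ≤ z + δ → Apart (K + K) δ 2 ⟨ roundTime R x , z , phase R h ⟩ ⟨ roundTime R′ x′ , z′ , phase R′ h′ ⟩
    distinct-leaves p q i≢i′ lt tri tri′ = apart-cmp tri tri′
      (λ t< → +-monoˡ-≤ 2 (phase-mono p q t<)) (λ t> → +-monoˡ-≤ 2 (phase-mono q p t>)) coincide
      where
      coincide : _ → _
      coincide eq with refl , refl ← time-injective p q eq = same-time p q i≢i′ lt tri tri′

    leaf-leaf : ∀ {y y′ i i′ R x z h R′ x′ z′ h′} → Leaf y i R x z h → Leaf y′ i′ R′ x′ z′ h′ → (y ≡ y′ → i ≢ i′) → ∣ y - y′ ∣ < δ →
      z ≤ z′ + δ → z′ ≤ z + δ →
      Apart (K + K) δ (starDist (suc i) (suc i′)) ⟨ roundTime R x , z , phase R h ⟩ ⟨ roundTime R′ x′ , z′ , phase R′ h′ ⟩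
    leaf-leaf {i = i} {i′} p q ne lt tri tri′ = by-leaf i i′
      (λ { refl → same-leaf p q (λ eq → ne eq refl) tri tri′ })
      (λ i≢i′ → subst (λ s → Apart (K + K) δ s _ _) (sym (starDist-leaves i≢i′)) (distinct-leaves p q i≢i′ lt tri tri′))

  four : ∀ {i i′} c → i < i′ → 4 * i + (c + 4) ≤ 4 * i′ + c
  four {i} {i′} c lt = linear (*-monoʳ-≤ 4 lt) 0 (eq i i′ c)
    where
    eq : ∀ i i′ c → 4 * i + (c + 4) + 4 * i′ + 0 ≡ 4 * i′ + c + 4 * suc i
    eq = solve-∀

  φ-left : ∀ {i i′} → i < i′ → 4 * i + 3 + 2 ≤ 4 * i′ + 3 + 0
  φ-left {i} {i′} lt = linear (four {i} {i′} 0 lt) 2 (eq (4 * i) (4 * i′))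
    where
    eq : ∀ a b → a + 3 + 2 + (b + 0) + 2 ≡ b + 3 + 0 + (a + (0 + 4))
    eq = solve-∀

  φ-right : ∀ {i i′} → i < i′ → 4 * i + 5 + 2 ≤ 4 * i′ + 3 + 0
  φ-right {i} {i′} lt = linear (four {i} {i′} 0 lt) 0 (eq (4 * i) (4 * i′))
    where
    eq : ∀ a b → a + 5 + 2 + (b + 0) + 0 ≡ b + 3 + 0 + (a + (0 + 4))
    eq = solve-∀

  φ-up : ∀ {a} b → a ≤ b + 3 + 0 → a ≤ b + 5 + 0
  φ-up b le = ≤-trans le (+-monoˡ-≤ 0 (+-monoʳ-≤ b (m≤m+n 3 2)))

  same-row : ∀ {x x′ i} → x + i ≡ j → x′ + i ≡ j → x ≡ x′
  same-row {x} {x′} {i} p p′ = +-cancelʳ-≡ i x x′ (trans p (sym p′))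

  i≤j : ∀ {x i} → x + i ≡ j → i ≤ j
  i≤j {x} {i} p = ≤-trans (m≤n+m i x) (≤-reflexive p)

  i<j : ∀ {x i} → 0 < x → x + i ≡ j → i < j
  i<j {x} {i} 0<x p = ≤-trans (+-monoˡ-≤ i 0<x) (≤-reflexive p)

  x≤j : ∀ {x i} → x + i ≡ j → x ≤ j
  x≤j {x} {i} p = ≤-trans (m≤m+n x i) (≤-reflexive p)

  module _ {δ : ℕ} where

    left-top : ∀ {x i} → x + i ≡ j → K + k ≤ x + δ →
      Sep (K + K) δ 0 ⟨ K + i , x , 4 * i + 3 ⟩ ⟨ k + j , K + k , 4 * j + 7 ⟩
    -- The direct step from (0 , 0) to (2k , 0). Time runs backwards here, so none of the general
    -- criteria applies and the labels are compared outright.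
    left-top {zero} {i} refl tri′ = sep (linear tri′ 0 (eq i δ))
      where
      eq : ∀ j δ → (3 + j + j) * (3 + j + (3 + j)) + 0 + (4 * j + 3) + (3 + j + (3 + j) + 2) + (0 + δ) + 0 ≡
        (2 + j + j) * (3 + j + (3 + j)) + (3 + j + (2 + j)) + (4 * j + 7) + (δ + 0) + (3 + j + (2 + j))
      eq = solve-∀
    left-top {suc x} {i} p tri′ = sep-pair (≤-trans (≤-reflexive (sym (+-suc k i))) (+-monoʳ-≤ k i<j′))
      (≤-trans (≤-reflexive (+-comm (suc x) K)) (+-monoʳ-≤ K (≤-trans (x≤j p) (≤-trans (n≤1+n j) (n≤1+n _)))))
      (linear (*-monoʳ-≤ 4 i<j′) 6 (eq i j)) tri′
      where
      i<j′ : i < j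
      i<j′ = i<j (s≤s z≤n) p
      eq : ∀ i j → 4 * i + 3 + 2 + 4 * j + 6 ≡ 4 * j + 7 + 0 + 4 * suc i
      eq = solve-∀

    right-top : ∀ {x i} → 0 < x → x + i ≡ j → K + x ≤ K + k + δ → K + k ≤ K + x + δ →
      Sep (K + K) δ 0 ⟨ K + i , K + x , 4 * i + 5 ⟩ ⟨ k + j , K + k , 4 * j + 7 ⟩
    -- Row k + 1 shares the time of row 2k; the k - 1 rows between them count twice.
    right-top {suc zero} {i} _ refl tri tri′ = sep-span (suc j) 0
      (≤-reflexive (sym (+-suc k i))) (≤-reflexive (trans (+-assoc K 1 (suc j)) refl)) (≤-reflexive (eq i))
      (≤-trans (≤-reflexive (+-identityʳ _)) tri′)
      where
      eq : ∀ i → 4 * i + 5 + (3 + suc i + (3 + suc i) + 2) ≡ 4 * suc i + 7 + 0 + (2 * suc (suc i) + 0)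
      eq = solve-∀
    right-top {suc (suc x)} {i} _ refl tri tri′ = sep-next
      (≤-trans (≤-reflexive (sym (trans (+-suc k (suc i)) (cong suc (+-suc k i))))) (+-monoʳ-≤ k (s≤s (s≤s (m≤n+m i x)))))
      (linear (*-monoʳ-≤ 4 (m≤n+m i x)) 8 (eq i x)) tri
      where
      eq : ∀ i x → 4 * i + 5 + 2 + 4 * (x + i) + 8 ≡ 4 * (2 + x + i) + 7 + 0 + 4 * i
      eq = solve-∀

    left-turnˡ : ∀ {x i} → x + i ≡ j → x ≤ suc j + δ → suc j ≤ x + δ →
      Sep (K + K) δ 0 ⟨ K + i , x , 4 * i + 3 ⟩ ⟨ K + j , suc j , 4 * j + 9 ⟩
    -- Row 0 and row k - 1 share a time although they lie on the same side, so the k - 1 rows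
    -- between them must supply the gap.
    left-turnˡ {zero} {i} refl tri tri′ = sep-span (suc j) 0 ≤-refl ≤-refl (≤-reflexive (eq j))
      (≤-trans (≤-reflexive (+-identityʳ _)) tri′)
      where
      eq : ∀ i → 4 * i + 3 + (3 + i + (3 + i) + 2) ≡ 4 * i + 9 + 0 + (2 * suc i + 0)
      eq = solve-∀
    left-turnˡ {suc x} {i} p tri tri′ = sep-next (+-monoʳ-< K (i<j (s≤s z≤n) p))
      (linear (*-monoʳ-≤ 4 (i≤j {suc x} p)) 4 (eq i j)) tri
      where
      eq : ∀ i j → 4 * i + 3 + 2 + 4 * j + 4 ≡ 4 * j + 9 + 0 + 4 * i
      eq = solve-∀

    left-turnʳ : ∀ {x i} → x + i ≡ j → x ≤ K + suc j + δ → K + suc j ≤ x + δ →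
      Sep (K + K) δ 0 ⟨ K + i , x , 4 * i + 3 ⟩ ⟨ K + j , K + suc j , 4 * j + 11 ⟩
    left-turnʳ {x} {i} p tri tri′ = sep-pair (+-monoʳ-≤ K (i≤j {x} p))
      (≤-trans (≤-reflexive (+-comm x K)) (+-monoʳ-≤ K (≤-trans (x≤j p) (n≤1+n j))))
      (linear (*-monoʳ-≤ 4 (i≤j {x} p)) 6 (eq i j)) tri′
      where
      eq : ∀ i j → 4 * i + 3 + 2 + 4 * j + 6 ≡ 4 * j + 11 + 0 + 4 * i
      eq = solve-∀

    right-turn : ∀ {x i z} c → 0 < x → x + i ≡ j → K + x ≤ z + δ →
      Sep (K + K) δ 0 ⟨ K + i , K + x , 4 * i + 5 ⟩ ⟨ K + j , z , 4 * j + (9 + c) ⟩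
    right-turn {x} {i} c 0<x p tri = sep-next (+-monoʳ-< K (i<j 0<x p))
      (linear (*-monoʳ-≤ 4 (i≤j {x} p)) (2 + c) (eq i j c)) tri
      where
      eq : ∀ i j c → 4 * i + 5 + 2 + 4 * j + (2 + c) ≡ 4 * j + (9 + c) + 0 + 4 * i
      eq = solve-∀

    top-turn : ∀ {z} c → K + k ≤ z + δ → Sep (K + K) δ 0 ⟨ k + j , K + k , 4 * j + 7 ⟩ ⟨ K + j , z , 4 * j + (9 + c) ⟩
    top-turn c tri = sep-next ≤-refl (linear ≤-refl c (eq j c)) tri
      where
      eq : ∀ j c → 4 * j + 7 + 2 + 0 + c ≡ 4 * j + (9 + c) + 0 + 0
      eq = solve-∀

    turn-turn : K + suc j ≤ suc j + δ → Sep (K + K) δ 0 ⟨ K + j , suc j , 4 * j + 9 ⟩ ⟨ K + j , K + suc j , 4 * j + 11 ⟩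
    turn-turn tri′ = sep-pair ≤-refl (≤-reflexive (+-comm (suc j) K)) (≤-reflexive (eq j)) tri′
      where
      eq : ∀ j → 4 * j + 9 + 2 ≡ 4 * j + 11 + 0
      eq = solve-∀

    left-right : ∀ {x i x′ i′} → x + i ≡ j → x′ + i′ ≡ j → x ≤ K + x′ + δ → K + x′ ≤ x + δ →
      Apart (K + K) δ 0 ⟨ K + i , x , 4 * i + 3 ⟩ ⟨ K + i′ , K + x′ , 4 * i′ + 5 ⟩
    left-right {x} {i} {x′} {i′} p p′ tri tri′ = apart-cmp tri tri′
      (λ lt → φ-up (4 * i′) (φ-left {i} {i′} (+-cancelˡ-< K i i′ lt)))
      (λ lt → φ-right {i′} {i} (+-cancelˡ-< K i′ i lt))
      (λ eq → inj₁ (pair-up (+-cancelˡ-≡ K i i′ eq)))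
      where
      pair-up : i ≡ i′ → Sep (K + K) δ 0 _ _
      pair-up refl = sep-pair ≤-refl (≤-trans (≤-reflexive (+-comm x K)) (≤-reflexive (cong (K +_) (same-row p p′)))) (≤-reflexive (eq (4 * i))) tri′
        where
        eq : ∀ a → a + 3 + 2 ≡ a + 5 + 0
        eq = solve-∀

    centre-centre : ∀ {y y′ σ τ} → Centre y σ → Centre y′ τ → y ≢ y′ →
      row σ ≤ row τ + δ → row τ ≤ row σ + δ → Apart (K + K) δ 0 σ τ
    centre-centre (left {x} {i} p) (left {x′} {i′} p′) ne tri tri′ = apart-cmp tri tri′
      (φ-left {i} {i′} ∘ +-cancelˡ-< K i i′) (φ-left {i′} {i} ∘ +-cancelˡ-< K i′ i) (λ eq → ⊥-elim (clash (+-cancelˡ-≡ K i i′ eq)))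
      where
      clash : i ≢ i′
      clash refl = ne (same-row p p′)
    centre-centre (right {x} {i} _ p) (right {x′} {i′} _ p′) ne tri tri′ = apart-cmp tri tri′
      (λ lt → φ-up (4 * i′) (φ-right {i} {i′} (+-cancelˡ-< K i i′ lt)))
      (λ lt → φ-up (4 * i) (φ-right {i′} {i} (+-cancelˡ-< K i′ i lt)))
      (λ eq → ⊥-elim (clash (+-cancelˡ-≡ K i i′ eq)))
      where
      clash : i ≢ i′
      clash refl = ne (cong (k +_) (same-row p p′))
    centre-centre (left p)    (right _ p′)  ne tri tri′ = left-right p p′ tri tri′
    centre-centre (left p)    top           ne tri tri′ = inj₁ (left-top p tri′)
    centre-centre (left p)    turnˡ         ne tri tri′ = inj₁ (left-turnˡ p tri tri′)
    centre-centre (left p)    turnʳ         ne tri tri′ = inj₁ (left-turnʳ p tri tri′)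
    centre-centre (right _ p) (left p′)     ne tri tri′ = Sum.swap (left-right p′ p tri′ tri)
    centre-centre (right 0<x p) top         ne tri tri′ = inj₁ (right-top 0<x p tri tri′)
    centre-centre (right 0<x p) turnˡ       ne tri tri′ = inj₁ (right-turn 0 0<x p tri)
    centre-centre (right 0<x p) turnʳ       ne tri tri′ = inj₁ (right-turn 2 0<x p tri)
    centre-centre top         (left p)      ne tri tri′ = inj₂ (left-top p tri)
    centre-centre top         (right 0<x p) ne tri tri′ = inj₂ (right-top 0<x p tri′ tri)
    centre-centre top         top           ne tri tri′ = ⊥-elim (ne refl)
    centre-centre top         turnˡ         ne tri tri′ = inj₁ (top-turn 0 tri)
    centre-centre top         turnʳ         ne tri tri′ = inj₁ (top-turn 2 tri)
    centre-centre turnˡ       (left p)      ne tri tri′ = inj₂ (left-turnˡ p tri′ tri)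
    centre-centre turnˡ       (right 0<x p) ne tri tri′ = inj₂ (right-turn 0 0<x p tri′)
    centre-centre turnˡ       top           ne tri tri′ = inj₂ (top-turn 0 tri′)
    centre-centre turnˡ       turnˡ         ne tri tri′ = ⊥-elim (ne refl)
    centre-centre turnˡ       turnʳ         ne tri tri′ = inj₁ (turn-turn tri′)
    centre-centre turnʳ       (left p)      ne tri tri′ = inj₂ (left-turnʳ p tri′ tri)
    centre-centre turnʳ       (right 0<x p) ne tri tri′ = inj₂ (right-turn 2 0<x p tri′)
    centre-centre turnʳ       top           ne tri tri′ = inj₂ (top-turn 2 tri′)
    centre-centre turnʳ       turnˡ         ne tri tri′ = inj₂ (turn-turn tri)
    centre-centre turnʳ       turnʳ         ne tri tri′ = ⊥-elim (ne refl)

  0<phase : ∀ R h → 0 < phase R h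
  0<phase zero    h = s≤s z≤n
  0<phase (suc R) h = s≤s z≤n

  late : ∀ R x → 0 < R ⊎ 0 < x → 1 < roundTime R x
  late zero    (suc x) _ = s≤s (s≤s z≤n)
  late (suc R) x       _ = s≤s (s≤s z≤n)
  late zero    zero    (inj₁ ())
  late zero    zero    (inj₂ ())

  centre-time : ∀ {y σ} → Centre y σ → time σ ≤ K + j
  centre-time (left {x} p)    = +-monoʳ-≤ K (i≤j {x} p)
  centre-time (right {x} _ p) = +-monoʳ-≤ K (i≤j {x} p)
  centre-time top             = n≤1+n _
  centre-time turnˡ           = ≤-refl
  centre-time turnʳ           = ≤-refl

  centre-extra : ∀ {y σ} → Centre y σ → extra σ ≤ 4 * j + 11
  centre-extra (left {x} p)    = +-mono-≤ (*-monoʳ-≤ 4 (i≤j {x} p)) (m≤m+n 3 8)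
  centre-extra (right {x} _ p) = +-mono-≤ (*-monoʳ-≤ 4 (i≤j {x} p)) (m≤m+n 5 6)
  centre-extra top             = +-monoʳ-≤ (4 * j) (m≤m+n 7 4)
  centre-extra turnˡ           = +-monoʳ-≤ (4 * j) (m≤m+n 9 2)
  centre-extra turnʳ           = ≤-refl

  interior : ∀ {y i R x z h} → Leaf y i R x z h → 0 < x → z < K + k
  interior (left _ lt _)  _ = <-≤-trans lt (m≤n+m k K)
  interior (right _ lt _) _ = +-monoʳ-< K lt

  module _ {δ : ℕ} where

    hub-centre : ∀ {y τ} → Centre y τ → K ≤ row τ + δ → Sep (K + K) δ 0 start τ
    hub-centre (left {i = i} _)    tri = sep-next (s≤s (s≤s z≤n)) (≤-trans (≤-trans (n≤1+n 2) (m≤n+m 3 (4 * i))) (m≤m+n _ 0)) tri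
    hub-centre (right {i = i} _ _) tri = sep-next (s≤s (s≤s z≤n)) (≤-trans (≤-trans (m≤m+n 2 3) (m≤n+m 5 (4 * i))) (m≤m+n _ 0)) tri
    hub-centre top                 tri = sep-next (s≤s (s≤s z≤n)) (≤-trans (≤-trans (m≤m+n 2 5) (m≤n+m 7 (4 * j))) (m≤m+n _ 0)) tri
    hub-centre turnˡ               tri = sep-next (s≤s (s≤s z≤n)) (≤-trans (≤-trans (m≤m+n 2 7) (m≤n+m 9 (4 * j))) (m≤m+n _ 0)) tri
    hub-centre turnʳ               tri = sep-next (s≤s (s≤s z≤n)) (≤-trans (≤-trans (m≤m+n 2 9) (m≤n+m 11 (4 * j))) (m≤m+n _ 0)) tri

    hub-leaf : ∀ {y i R x z h} → Leaf y i R x z h → ∣ k - y ∣ < δ → K ≤ z + δ → z ≤ K + δ →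
      Sep (K + K) δ 1 start ⟨ roundTime R x , z , phase R h ⟩
    hub-leaf {R = R} {x} {z} {h} p lt tri tri′ = go p lt tri tri′
      where
      next : ∀ {R x z h} → 0 < R ⊎ 0 < x → K ≤ z + δ → Sep (K + K) δ 1 start ⟨ roundTime R x , z , phase R h ⟩
      next {R} {x} {h = h} pos = sep-next (late R x pos) (+-monoˡ-≤ 1 (0<phase R h))
      go : ∀ {y i R x z h} → Leaf y i R x z h → ∣ k - y ∣ < δ → K ≤ z + δ → z ≤ K + δ →
        Sep (K + K) δ 1 start ⟨ roundTime R x , z , phase R h ⟩
      go (bottom (step _))    _ tri _ = next (inj₁ (s≤s z≤n)) tri
      go (bottom (wrap refl)) _ tri _ = next {n} (inj₁ (≤-trans (s≤s z≤n) 3≤n)) tri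
      go (left {i = i} 0<x _ _)       _ tri _ = next {i} (inj₂ 0<x) tri
      go (hub _)              _ tri _ = next (inj₁ (s≤s z≤n)) tri
      go (right {R = R} 0<x _ _)      _ tri _ = next {R} (inj₂ 0<x) tri
      go (top {R = suc R} _)  _ tri _ = next {suc R} (inj₁ (s≤s z≤n)) tri
      go (top {R = zero} _)   lt _ _  = sep-span k 1 ≤-refl ≤-refl (≤-reflexive (eq j))
        (≤-trans (≤-reflexive (+-assoc K k 1)) (+-monoʳ-≤ K (≤-trans (≤-reflexive (trans (+-comm k 1) (cong suc (sym (∣m-m+n∣≡n k k))))) lt)))
        where
        eq : ∀ j → 0 + (3 + j + (3 + j) + 2) ≡ 2 + 1 + (2 * (2 + j) + 1)
        eq = solve-∀

    first-round-centre : ∀ {y y′ i x z h σ} → Leaf y i 0 x z h → Centre y′ σ → z ≤ row σ + δ → row σ ≤ z + δ →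
      Sep (K + K) δ 1 ⟨ suc x , z , suc h ⟩ σ
    first-round-centre {x = x} {z} {h} p c tri tri′ = go c tri tri′
      where
      four≤ : ∀ {φ} → 3 ≤ φ → suc h + 2 ≤ φ + 1
      four≤ 3≤φ = ≤-trans (+-monoˡ-≤ 2 (s≤s (h≤1 p))) (+-monoˡ-≤ 1 3≤φ)
      next : ∀ {t z′ φ} → K ≤ t → 3 ≤ φ → z ≤ z′ + δ → Sep (K + K) δ 1 ⟨ suc x , z , suc h ⟩ ⟨ t , z′ , φ ⟩
      next K≤t 3≤φ = sep-next (<-≤-trans (s≤s (x<k p)) K≤t) (four≤ 3≤φ)
      to-top : suc x < k + j ⊎ suc x ≡ k + j → z ≤ K + k + δ → K + k ≤ z + δ → Sep (K + K) δ 1 ⟨ suc x , z , suc h ⟩ ⟨ k + j , K + k , 4 * j + 7 ⟩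
      to-top (inj₁ lt) tri _ = sep-next lt (four≤ (≤-trans (m≤m+n 3 4) (m≤n+m 7 (4 * j)))) tri
      -- As x < k, equal times force j = 0 and x = k - 1: this is m = 5, at the last pair of round
      -- 0. A rise by a single row is enough.
      to-top (inj₂ eq) _ tri′ = sep-span 1 0 (≤-reflexive eq)
        (≤-trans (≤-reflexive (+-comm z 1)) (interior p (s≤s⁻¹ (≤-trans (m≤m+n 2 (j + j)) (≤-reflexive (trans (sym (+-assoc 2 j j)) (sym eq)))))))
        (linear (h≤1 p) (2 * j) (eq′ j h)) (≤-trans (≤-reflexive (+-identityʳ (K + k))) tri′)
        where
        eq′ : ∀ j h → suc h + (3 + j + (3 + j) + 2) + 1 + 2 * j ≡ 4 * j + 7 + 1 + (2 * 1 + 0) + h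
        eq′ = solve-∀
      go : ∀ {y σ} → Centre y σ → z ≤ row σ + δ → row σ ≤ z + δ → Sep (K + K) δ 1 ⟨ suc x , z , suc h ⟩ σ
      go (left {i = i} _)    tri _ = next (m≤m+n K i) (m≤n+m 3 (4 * i)) tri
      go (right {i = i} _ _) tri _ = next (m≤m+n K i) (≤-trans (m≤m+n 3 2) (m≤n+m 5 (4 * i))) tri
      go top tri tri′ = to-top (m≤n⇒m<n∨m≡n (≤-trans (x<k p) (m≤m+n k j))) tri tri′
      go turnˡ               tri _ = next (m≤m+n K j) (≤-trans (m≤m+n 3 6) (m≤n+m 9 (4 * j))) tri
      go turnʳ               tri _ = next (m≤m+n K j) (≤-trans (m≤m+n 3 8) (m≤n+m 11 (4 * j))) tri

    -- Round 0 comes before these centre vertices, all other rounds after them.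
    centre-leaf : ∀ {y y′ i R x z h σ} → Centre y σ → Leaf y′ i R x z h → row σ ≤ z + δ → z ≤ row σ + δ →
      Apart (K + K) δ 1 σ ⟨ roundTime R x , z , phase R h ⟩
    centre-leaf {R = zero} c p tri tri′ = inj₂ (first-round-centre p c tri′ tri)
    centre-leaf {R = suc R} {x} {h = h} c p tri tri′ = inj₁ (sep-next
      (linear (centre-time c) (R * k + x) (eq j R x _))
      (linear (centre-extra c) (R + h) (eq′ j R h _)) tri)
      where
      eq : ∀ j R x t → suc t + (3 + j + j) + (R * (2 + j) + x) ≡ (2 + R) * (2 + j) + x + t
      eq = solve-∀
      eq′ : ∀ j R h φ → φ + 2 + (4 * j + 11) + (R + h) ≡ 4 * (2 + j) + 4 + R + h + 1 + φ
      eq′ = solve-∀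

    apart : ∀ {y y′ a b σ τ} → At y a σ → At y′ b τ → (y ≡ y′ → a ≢ b) → ∣ y - y′ ∣ < δ →
      row σ ≤ row τ + δ → row τ ≤ row σ + δ → Apart (K + K) δ (starDist a b) σ τ
    apart hub        hub        ne lt tri tri′ = ⊥-elim (ne refl refl)
    apart hub        (centre q) ne lt tri tri′ = inj₁ (hub-centre q tri)
    apart hub        (leaf q)   ne lt tri tri′ = inj₁ (hub-leaf q lt tri tri′)
    apart (centre p) hub        ne lt tri tri′ = inj₂ (hub-centre p tri′)
    apart (centre p) (centre q) ne lt tri tri′ = centre-centre p q (λ eq → ne eq refl) tri tri′
    apart (centre p) (leaf q)   ne lt tri tri′ = centre-leaf p q tri tri′
    apart {y} (leaf p) hub      ne lt tri tri′ = inj₂ (hub-leaf p (subst (_< δ) (∣-∣-comm y k) lt) tri′ tri)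
    apart (leaf p)   (centre q) ne lt tri tri′ = Sum.swap (centre-leaf q p tri′ tri)
    apart (leaf p)   (leaf q)   ne lt tri tri′ = leaf-leaf p q (λ eq i≡i′ → ne eq (cong suc i≡i′)) lt tri tri′

  row-At : ∀ {y a σ} → At y a σ → y ≤ row σ × row σ ≤ suc y
  row-At hub                        = n≤1+n k , ≤-refl
  row-At (centre (left _))          = ≤-refl , n≤1+n _
  row-At (centre (right _ _))       = n≤1+n _ , ≤-refl
  row-At (centre top)               = n≤1+n _ , ≤-refl
  row-At (centre turnˡ)             = ≤-refl , n≤1+n _
  row-At (centre turnʳ)             = n≤1+n _ , ≤-refl
  row-At (leaf (bottom _))          = ≤-refl , z≤n
  row-At (leaf (left _ _ _))        = ≤-refl , n≤1+n _
  row-At (leaf (hub _))             = n≤1+n k , ≤-refl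
  row-At (leaf (right _ _ _))       = n≤1+n _ , ≤-refl
  row-At (leaf (top _))             = n≤1+n _ , ≤-refl

  slot : ∀ y a → y ≤ k + k → a ≤ n → ∃ (At y a)
  slot y a y≤2k a≤n with y <? k
  slot y zero y≤2k a≤n | yes (s≤s y≤1+j) with m≤n⇒m<n∨m≡n y≤1+j
  ... | inj₁ (s≤s y≤j) = _ , centre (left (m+[n∸m]≡n y≤j))
  ... | inj₂ refl      = _ , centre turnˡ
  slot zero    (suc zero)    _ a≤n | yes _   = _ , leaf (bottom (wrap refl))
  slot zero    (suc (suc i)) _ a≤n | yes _   = _ , leaf (bottom (step a≤n))
  slot (suc y) (suc i)       _ a≤n | yes y<k = _ , leaf (left (s≤s z≤n) y<k a≤n)
  slot y a y≤2k a≤n | no y≮k with m≤n⇒∃[o]m+o≡n (≮⇒≥ y≮k)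
  slot _ zero    _ a≤n | no _ | zero , refl = subst (λ y → ∃ (At y 0)) (sym (+-identityʳ k)) (_ , hub)
  slot _ (suc i) _ a≤n | no _ | zero , refl = subst (λ y → ∃ (At y (suc i))) (sym (+-identityʳ k)) (_ , leaf (hub a≤n))
  slot _ a y≤2k a≤n | no _ | suc x , refl with m≤n⇒m<n∨m≡n (+-cancelˡ-≤ k (suc x) k y≤2k)
  slot _ zero          _ a≤n | no _ | suc x , refl | inj₂ refl = _ , centre top
  slot _ (suc zero)    _ a≤n | no _ | suc x , refl | inj₂ refl = _ , leaf (top (wrap (m+[n∸m]≡n (≤-trans (s≤s z≤n) 3≤n))))
  slot _ (suc (suc i)) _ a≤n | no _ | suc x , refl | inj₂ refl = _ , leaf (top (step a≤n))
  slot _ zero          _ a≤n | no _ | suc x , refl | inj₁ (s≤s x<1+j) with m≤n⇒m<n∨m≡n x<1+j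
  ... | inj₁ (s≤s x≤j) = _ , centre (right (s≤s z≤n) (m+[n∸m]≡n x≤j))
  ... | inj₂ refl      = _ , centre turnʳ
  slot _ (suc i) _ a≤n | no _ | suc x , refl | inj₁ x<k with m≤n⇒m<n∨m≡n a≤n
  ... | inj₁ lt = _ , leaf (right (s≤s z≤n) x<k (step lt))
  ... | inj₂ eq = _ , leaf (right (s≤s z≤n) x<k (wrap eq))

  -- The middle row over the last leaf: of weight 2 and adjacent to `start`, whose weight is 0.
  end : Slot
  end = ⟨ roundTime n 0 , K , phase n 0 ⟩

  At-start : ∀ {y σ} → y ≡ k → At y 0 σ → σ ≡ start
  At-start eq hub                            = refl
  At-start eq (centre (left {x} {i} p))      = ⊥-elim (<⇒≢ (s≤s (≤-trans (x≤j p) (n≤1+n j))) eq)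
  At-start eq (centre (right {x} 0<x _))     = ⊥-elim (<⇒≢ (m<m+n k 0<x) (sym eq))
  At-start eq (centre top)                   = ⊥-elim (<⇒≢ (m<m+n k 0<k) (sym eq))
  At-start eq (centre turnˡ)                 = ⊥-elim (1+n≢n (sym eq))
  At-start eq (centre turnʳ)                 = ⊥-elim (<⇒≢ (m<m+n k (s≤s z≤n)) (sym eq))

  At-end : ∀ {y a σ} → y ≡ k → a ≡ n → At y a σ → σ ≡ end
  At-end eq refl hub                       = ⊥-elim (<⇒≱ 3≤n z≤n)
  At-end eq refl (centre _)                = ⊥-elim (<⇒≱ 3≤n z≤n)
  At-end eq refl (leaf (bottom _))         = ⊥-elim (0≢1+n eq)
  At-end eq refl (leaf (left _ x<k _))     = ⊥-elim (<⇒≢ x<k eq)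
  At-end eq refl (leaf (hub _))            = refl
  At-end eq refl (leaf (right 0<x _ _))    = ⊥-elim (<⇒≢ (m<m+n k 0<x) (sym eq))
  At-end eq refl (leaf (top _))            = ⊥-elim (<⇒≢ (m<m+n k 0<k) (sym eq))

  0<n : 0 < n
  0<n = ≤-trans (s≤s z≤n) 3≤n

  centre-late : ∀ {y σ} → Centre y σ → 1 < time σ
  centre-late (left _)    = s≤s (s≤s z≤n)
  centre-late (right _ _) = s≤s (s≤s z≤n)
  centre-late top         = s≤s (s≤s z≤n)
  centre-late turnˡ       = s≤s (s≤s z≤n)
  centre-late turnʳ       = s≤s (s≤s z≤n)

  centre-before-leaves : ∀ R → 0 < R → K + j < roundTime R 0 × 4 * j + 11 ≤ phase R 0
  centre-before-leaves (suc R) _ = linear ≤-refl (R * k) (eq j R) , linear ≤-refl (1 + R) (eq′ j R)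
    where
    eq : ∀ j R → suc (3 + j + j) + 0 + R * (2 + j) ≡ (2 + R) * (2 + j) + 0 + 0
    eq = solve-∀
    eq′ : ∀ j R → 4 * j + 11 + 0 + (1 + R) ≡ 4 * (2 + j) + 4 + R + 0 + 0
    eq′ = solve-∀

  K≤M : K ≤ K + K
  K≤M = m≤m+n K K

  start≤ : ∀ {y a σ} → At y a σ → label (K + K) start ≤ label (K + K) σ
  start≤ hub        = ≤-refl
  start≤ (centre c) = label-mono (centre-late c) K≤M z≤n
  start≤ (leaf p)   = go p
    where
    next : ∀ {R x z h} → 0 < R ⊎ 0 < x → label (K + K) start ≤ label (K + K) ⟨ roundTime R x , z , phase R h ⟩
    next {R} {x} pos = label-mono (late R x pos) K≤M z≤n
    go : ∀ {y i R x z h} → Leaf y i R x z h → label (K + K) start ≤ label (K + K) ⟨ roundTime R x , z , phase R h ⟩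
    go (bottom (step {i} _))        = next {suc i} (inj₁ (s≤s z≤n))
    go (bottom (wrap refl))         = next {n} (inj₁ 0<n)
    go (left {i = i} 0<x _ _)       = next {i} (inj₂ 0<x)
    go (hub {i} _)                  = next {suc i} (inj₁ (s≤s z≤n))
    go (right {R = R} 0<x _ _)      = next {R} (inj₂ 0<x)
    go (top {R = suc R} _)          = next {suc R} (inj₁ (s≤s z≤n))
    go (top {R = zero} _)           = +-mono-≤ (+-monoʳ-≤ (1 * (K + K)) (m≤m+n K k)) z≤n

  ≤end : ∀ {y a σ} → y ≤ k + k → At y a σ → label (K + K) σ ≤ label (K + K) end
  ≤end {σ = σ} y≤2k p = go p
    where
    z≤M : row σ ≤ K + K
    z≤M = ≤-trans (proj₂ (row-At p)) (≤-trans (s≤s y≤2k) (s≤s (+-monoʳ-≤ k (n≤1+n k))))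
    earlier : ∀ {y i R x z h} → Leaf y i R x z h → R < n → z ≤ K + K →
      label (K + K) ⟨ roundTime R x , z , phase R h ⟩ ≤ label (K + K) end
    earlier q lt z≤M = label-mono (time-< 0 lt (x<k q)) z≤M (phase-< 0 (h≤1 q) lt)
    go : At _ _ σ → label (K + K) σ ≤ label (K + K) end
    go hub        = label-mono (≤-<-trans (s≤s z≤n) (proj₁ (centre-before-leaves n 0<n))) K≤M z≤n
    go (centre c) = label-mono (≤-<-trans (centre-time c) (proj₁ (centre-before-leaves n 0<n))) z≤M
      (≤-trans (centre-extra c) (proj₂ (centre-before-leaves n 0<n)))
    go (leaf q@(bottom (step lt)))          = earlier q lt z≤M
    -- Row 0 over leaf 0 agrees with `end` in time and delay; only its row number is smaller.
    go (leaf (bottom (wrap refl)))          = +-monoˡ-≤ (phase n 0) (+-monoʳ-≤ (roundTime n 0 * (K + K)) z≤n)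
    go (leaf q@(left _ _ i<n))              = earlier q i<n z≤M
    go (leaf q@(hub i<n)) with m≤n⇒m<n∨m≡n i<n
    ... | inj₁ lt   = earlier q lt z≤M
    ... | inj₂ refl = ≤-refl
    go (leaf q@(right _ _ (step lt)))       = earlier q lt z≤M
    go (leaf q@(right _ _ (wrap _)))        = earlier q 0<n z≤M
    go (leaf q@(top (step lt)))             = earlier q (<-trans (n<1+n _) lt) z≤M
    go (leaf q@(top (wrap eq)))             = earlier q (≤-reflexive eq) z≤M

  open Product (suc (k + k)) n

  vertex-slot : ∀ (u : V G) → ∃ (At (toℕ (proj₁ u)) (toℕ (proj₂ u)))
  vertex-slot (i , a) = slot (toℕ i) (toℕ a) (toℕ≤pred[n] i) (toℕ≤pred[n] a)

  labeling : V G → ℕ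
  labeling u = label (K + K) (proj₁ (vertex-slot u))

  separated : ∀ u v → u ≢ v → suc (k + k) + 2 ≤ ∣ labeling u - labeling v ∣ + dist u v
  separated u@(i , a) v@(j , b) u≢v with vertex-slot u | vertex-slot v
  -- Here M + 2 = m + 3, and δ is the row distance plus one; the surplus units cancel.
  ... | σ , p | τ , q = s≤s⁻¹ (≤-trans (≤-reflexive (cong suc (cong (_+ 2) (sym (+-suc k k)))))
    (≤-trans (Apart⇒∣-∣ {σ = σ} {τ} (apart p q
        (λ i≡j a≡b → u≢v (cong₂ _,_ (toℕ-injective i≡j) (toℕ-injective a≡b))) ≤-refl
        (near (proj₂ (row-At p)) (proj₁ (row-At q)) (m≤n+∣m-n∣ (toℕ i) (toℕ j)))
        (near (proj₂ (row-At q)) (proj₁ (row-At p)) (m≤n+∣n-m∣ (toℕ j) (toℕ i)))))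
      (≤-reflexive (+-suc _ _))))
    where
    near : ∀ {y z y′ z′ d} → z ≤ suc y → y′ ≤ z′ → y ≤ y′ + d → z ≤ z′ + suc d
    near {d = d} z≤ y′≤ y≤ = ≤-trans z≤ (≤-trans (s≤s (≤-trans y≤ (+-monoˡ-≤ d y′≤))) (≤-reflexive (sym (+-suc _ d))))

theorem-odd : ∀ k n → 2 ≤ k → 3 ≤ n → IsRadioNumber (P (suc (k + k)) □ K1 n)
  ⌊ (suc (k + k) * suc (k + k) * (n + 1) + 2 * suc (k + k) + n ∸ 1) /2⌋
theorem-odd (suc (suc j)) n@(suc n₀) (s≤s (s≤s z≤n)) 3≤n = radioNumber (suc (k + k)) n (s≤s (m≤m+n 2 (j + k))) 3≤n
  labeling first last separated bounds r width tight
  where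
  open Odd j n 3≤n
  open Product (suc (k + k)) n
  k<m : k < suc (k + k)
  k<m = s≤s (m≤m+n k k)
  first last : V G
  first = fromℕ< k<m , Fin.zero
  last  = fromℕ< k<m , Fin.fromℕ n
  label-first : labeling first ≡ label (K + K) start
  label-first = cong (label (K + K)) (At-start (toℕ-fromℕ< k<m) (proj₂ (vertex-slot first)))
  label-last : labeling last ≡ label (K + K) end
  label-last = cong (label (K + K)) (At-end (toℕ-fromℕ< k<m) (Fin.toℕ-fromℕ n) (proj₂ (vertex-slot last)))
  bounds : ∀ w → labeling first ≤ labeling w × labeling w ≤ labeling last
  bounds w = ≤-trans (≤-reflexive label-first) (start≤ (proj₂ (vertex-slot w)))
           , ≤-trans (≤end (toℕ≤pred[n] (proj₁ w)) (proj₂ (vertex-slot w))) (≤-reflexive (sym label-last))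
  half : ℕ
  half = 2 * (k * suc k) * (n + 1) + 2 * k + 1 + n
  r : ℕ
  r = ⌊ (suc (k + k) * suc (k + k) * (n + 1) + 2 * suc (k + k) + n ∸ 1) /2⌋
  r≡half : r ≡ half
  r≡half = trans (cong ⌊_/2⌋ (trans (cong (_∸ 1) (+-suc (suc (k + k) * suc (k + k) * (n + 1) + 2 * suc (k + k)) n₀)) (double k n₀)))
    (sym (n≡⌊n+n/2⌋ half))
    where
    double : ∀ k n → suc (k + k) * suc (k + k) * (suc n + 1) + 2 * suc (k + k) + n ≡
      2 * (k * suc k) * (suc n + 1) + 2 * k + 1 + suc n + (2 * (k * suc k) * (suc n + 1) + 2 * k + 1 + suc n)
    double = solve-∀
  width : labeling last ≡ labeling first + r
  width = trans label-last (trans (eq k n₀) (sym (cong₂ _+_ label-first r≡half)))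
    where
    eq : ∀ k n → ((2 + n) * k + 0) * (suc k + suc k) + suc k + (4 * k + 4 + n + 0) ≡
      1 * (suc k + suc k) + suc k + 0 + (2 * (k * suc k) * (suc n + 1) + 2 * k + 1 + suc n)
    eq = solve-∀
  tight : r + totalWeight (suc (k + k)) n + (suc (k + k) + 2) ≡ (suc (k + k) + 2) * (suc (k + k) * suc n) + 1
  tight = trans (cong₂ (λ a b → a + (suc n * b + suc (k + k) * (2 * n)) + (suc (k + k) + 2)) r≡half (rowWeights-odd k)) (eq k n)
    where
    eq : ∀ k n → 2 * (k * suc k) * (n + 1) + 2 * k + 1 + n + (suc n * (2 * (k * suc k)) + suc (k + k) * (2 * n)) + (suc (k + k) + 2) ≡
      (suc (k + k) + 2) * (suc (k + k) * suc n) + 1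
    eq = solve-∀

-- The case m = 3 with n ≥ 4

-- For m = 3 there are no pairs of rows besides the middle; the label is 5 R + c with c fixed by the row.
module Three (n : ℕ) (4≤n : 4 ≤ n) where

  -- Over distinct leaves the cycle of rows 1, 2, 0, 1 has distances 3, 4, 3, so the labels advance
  -- by 2, 1, 2, together 5 per round.
  data Offset : (y c : ℕ) → Set where
    hub    : Offset 1 3
    top    : Offset 2 5
    bottom : Offset 0 6

  -- Modulo n, round R has leaf R - 1 in row 1, R - 2 in row 2 and R + 1 in row 0. The last two
  -- differ by 3, hence the need for n ≥ 4.
  data Round : (y i R : ℕ) → Set where
    hub         : ∀ {i} → i < n → Round 1 i (suc i)
    top         : ∀ {i} → suc i < n → Round 2 i (2 + i)
    top-wrap    : ∀ {i} → suc i ≡ n → Round 2 i 1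
    bottom      : ∀ {i} → suc i < n → Round 0 (suc i) i
    bottom-wrap : ∀ {R} → suc R ≡ n → Round 0 0 R

  -- The centre vertices stay outside the rounds: those of rows 1 and 2 open the order and that of
  -- row 0 closes it. The first and last are adjacent, with weights 0 and 2.
  data At : (y a v : ℕ) → Set where
    hub    : At 1 0 0
    top    : At 2 0 4
    bottom : At 0 0 (5 * n + 7)
    leaf   : ∀ {y i R c} → Offset y c → Round y i R → At y (suc i) (5 * R + c)

  Apart₅ : (d v w : ℕ) → Set
  Apart₅ d v w = v + 5 ≤ w + d ⊎ w + 5 ≤ v + d

  -- Tight only from `bottom` to `hub`, the step into the next round.
  Offset-spread : ∀ {y y′ c c′} → Offset y c → Offset y′ c′ → c ≤ c′ + (∣ y - y′ ∣ + 2)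
  Offset-spread hub    hub    = m≤m+n 3 2
  Offset-spread hub    top    = m≤m+n 3 5
  Offset-spread hub    bottom = m≤m+n 3 6
  Offset-spread top    hub    = m≤m+n 5 1
  Offset-spread top    top    = m≤m+n 5 2
  Offset-spread top    bottom = m≤m+n 5 5
  Offset-spread bottom hub    = ≤-refl
  Offset-spread bottom top    = m≤m+n 6 3
  Offset-spread bottom bottom = m≤m+n 6 2

  Offset-bounds : ∀ {y c} → Offset y c → 3 ≤ c × c ≤ 6
  Offset-bounds hub    = ≤-refl , m≤m+n 3 3
  Offset-bounds top    = m≤m+n 3 2 , m≤m+n 5 1
  Offset-bounds bottom = m≤m+n 3 3 , ≤-refl

  Round-injective : ∀ {y i i′ R} → Round y i R → Round y i′ R → i ≡ i′
  Round-injective (hub _)          (hub _)          = refl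
  Round-injective (top _)          (top _)          = refl
  Round-injective (top-wrap eq)    (top-wrap eq′)   = suc-injective (trans eq (sym eq′))
  Round-injective (bottom _)       (bottom _)       = refl
  Round-injective (bottom lt)      (bottom-wrap eq) = ⊥-elim (<⇒≢ lt eq)
  Round-injective (bottom-wrap eq) (bottom lt)      = ⊥-elim (<⇒≢ lt eq)
  Round-injective (bottom-wrap _)  (bottom-wrap _)  = refl

  later-round : ∀ {R R′ c c′} d → R < R′ → c ≤ c′ + d → 5 * R + c + 5 ≤ 5 * R′ + c′ + d
  later-round {R} {R′} {c} {c′} d lt le = linear (+-mono-≤ (*-monoʳ-≤ 5 lt) le) 0 (eq R R′ c c′ d)
    where
    eq : ∀ R R′ c c′ d → 5 * R + c + 5 + (5 * R′ + (c′ + d)) + 0 ≡ 5 * R′ + c′ + d + (5 * suc R + c)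
    eq = solve-∀

  far-round : ∀ {R R′ c c′} d → 2 + R ≤ R′ → c ≤ 6 → 3 ≤ c′ → 5 * R + c + 5 ≤ 5 * R′ + c′ + d
  far-round {R} {R′} {c} {c′} d lt c≤6 3≤c′ = linear (+-mono-≤ (*-monoʳ-≤ 5 lt) (+-mono-≤ c≤6 3≤c′)) (2 + d) (eq R R′ c c′ d)
    where
    eq : ∀ R R′ c c′ d → 5 * R + c + 5 + (5 * R′ + (6 + c′)) + (2 + d) ≡ 5 * R′ + c′ + d + (5 * (2 + R) + (c + 3))
    eq = solve-∀

  same-round : ∀ R {c c′ d} → c + 5 ≤ c′ + d → 5 * R + c + 5 ≤ 5 * R + c′ + d
  same-round R {c} {c′} {d} le = ≤-trans (≤-reflexive (+-assoc (5 * R) c 5))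
    (≤-trans (+-monoʳ-≤ (5 * R) le) (≤-reflexive (sym (+-assoc (5 * R) c′ d))))

  distinct-leaves : ∀ {y y′ i i′ R R′ c c′} → Offset y c → Round y i R → Offset y′ c′ → Round y′ i′ R′ → i ≢ i′ →
    Apart₅ (∣ y - y′ ∣ + 2) (5 * R + c) (5 * R′ + c′)
  distinct-leaves {y} {y′} {R = R} {R′} {c} {c′} o r o′ r′ i≢i′ with <-cmp R R′
  ... | tri< lt _ _ = inj₁ (later-round {R} {R′} _ lt (Offset-spread o o′))
  ... | tri> _ _ gt = inj₂ (later-round {R′} {R} _ gt (subst (λ d → c′ ≤ c + (d + 2)) (∣-∣-comm y′ y) (Offset-spread o′ o)))
  ... | tri≈ _ refl _ = coincide o o′ r r′
    where
    coincide : ∀ {y y′ c c′} → Offset y c → Offset y′ c′ → Round y _ R → Round y′ _ R →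
      Apart₅ (∣ y - y′ ∣ + 2) (5 * R + c) (5 * R + c′)
    coincide hub    hub    r r′ = ⊥-elim (i≢i′ (Round-injective r r′))
    coincide hub    top    _ _  = inj₁ (same-round R ≤-refl)
    coincide hub    bottom _ _  = inj₁ (same-round R (n≤1+n 8))
    coincide top    hub    _ _  = inj₂ (same-round R ≤-refl)
    coincide top    top    r r′ = ⊥-elim (i≢i′ (Round-injective r r′))
    coincide top    bottom _ _  = inj₁ (same-round R ≤-refl)
    coincide bottom hub    _ _  = inj₂ (same-round R (n≤1+n 8))
    coincide bottom top    _ _  = inj₂ (same-round R ≤-refl)
    coincide bottom bottom r r′ = ⊥-elim (i≢i′ (Round-injective r r′))

  hub-top : ∀ {i R R′} d → Round 1 i R → Round 2 i R′ → Apart₅ d (5 * R + 3) (5 * R′ + 5)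
  hub-top {R = R} {R′} d (hub _) (top _)       = inj₁ (later-round {R} {R′} d ≤-refl (m≤m+n 3 (2 + d)))
  hub-top {R = R} {R′} d (hub _) (top-wrap eq) = inj₂ (far-round {R′} {R} d
    (≤-trans (≤-trans (n≤1+n 3) 4≤n) (≤-reflexive (sym eq))) (n≤1+n 5) ≤-refl)

  hub-bottom : ∀ {i R R′} d → Round 1 i R → Round 0 i R′ → Apart₅ d (5 * R + 3) (5 * R′ + 6)
  hub-bottom {R = R} {R′} d (hub _) (bottom _)       = inj₂ (far-round {R′} {R} d ≤-refl ≤-refl ≤-refl)
  hub-bottom {R = R} {R′} d (hub _) (bottom-wrap eq) = inj₁ (far-round {R} {R′} d
    (s≤s⁻¹ (≤-trans 4≤n (≤-reflexive (sym eq)))) (m≤m+n 3 3) (m≤m+n 3 3))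

  top-bottom : ∀ {i R R′} d → Round 2 i R → Round 0 i R′ → Apart₅ d (5 * R + 5) (5 * R′ + 6)
  top-bottom {R = R} {R′} d (top _)       (bottom _)       = inj₂ (far-round {R′} {R} d (n≤1+n _) ≤-refl (m≤m+n 3 2))
  top-bottom {R = R} {R′} d (top _)       (bottom-wrap eq) = inj₁ (later-round {R} {R′} d
    (s≤s⁻¹ (≤-trans 4≤n (≤-reflexive (sym eq)))) (m≤m+n 5 (1 + d)))
  top-bottom {R = R} {R′} d (top-wrap eq) (bottom _)       = inj₁ (later-round {R} {R′} d
    (s≤s⁻¹ (s≤s⁻¹ (≤-trans 4≤n (≤-reflexive (sym eq))))) (m≤m+n 5 (1 + d)))
  top-bottom d (top-wrap eq) (bottom-wrap _) = ⊥-elim (<⇒≱ 4≤n (≤-trans (≤-reflexive (sym eq)) (s≤s z≤n)))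

  same-leaf : ∀ {y y′ i R R′ c c′} d → Offset y c → Round y i R → Offset y′ c′ → Round y′ i R′ → y ≢ y′ →
    Apart₅ d (5 * R + c) (5 * R′ + c′)
  same-leaf d hub    r hub    r′ ne = ⊥-elim (ne refl)
  same-leaf d hub    r top    r′ ne = hub-top d r r′
  same-leaf d hub    r bottom r′ ne = hub-bottom d r r′
  same-leaf d top    r hub    r′ ne = Sum.swap (hub-top d r′ r)
  same-leaf d top    r top    r′ ne = ⊥-elim (ne refl)
  same-leaf d top    r bottom r′ ne = top-bottom d r r′
  same-leaf d bottom r hub    r′ ne = Sum.swap (hub-bottom d r′ r)
  same-leaf d bottom r top    r′ ne = Sum.swap (top-bottom d r′ r)
  same-leaf d bottom r bottom r′ ne = ⊥-elim (ne refl)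

  round≤ : ∀ {y i R} → Round y i R → R ≤ n
  round≤ (hub i<n)        = i<n
  round≤ (top lt)         = lt
  round≤ (top-wrap _)     = ≤-trans (s≤s z≤n) 4≤n
  round≤ (bottom lt)      = ≤-trans (n≤1+n _) (<⇒≤ lt)
  round≤ (bottom-wrap eq) = ≤-trans (n≤1+n _) (≤-reflexive eq)

  bottom-round< : ∀ {i R} → Round 0 i R → R < n
  bottom-round< (bottom lt)      = <-trans (n<1+n _) lt
  bottom-round< (bottom-wrap eq) = ≤-reflexive eq

  hub-leaf : ∀ {y i R c} d → Offset y c → Round y i R → 0 + 5 ≤ 5 * R + c + d
  hub-leaf {R = R} d top    _           = ≤-trans (m≤n+m 5 (5 * R)) (m≤m+n _ d)
  hub-leaf {R = R} d bottom _           = ≤-trans (n≤1+n 5) (≤-trans (m≤n+m 6 (5 * R)) (m≤m+n _ d))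
  hub-leaf d hub (hub {i} _)            = ≤-trans (≤-trans (*-monoʳ-≤ 5 {1} {suc i} (s≤s z≤n)) (m≤m+n _ 3)) (m≤m+n _ d)

  top-leaf : ∀ {y i R c} → Offset y c → Round y i R → 4 + 5 ≤ 5 * R + c + (∣ 2 - y ∣ + 1)
  top-leaf hub    (hub {i} _)  = ≤-trans (n≤1+n 9) (+-monoˡ-≤ 2 (+-monoˡ-≤ 3 (*-monoʳ-≤ 5 {1} {suc i} (s≤s z≤n))))
  top-leaf top    (top {i} _)  = ≤-trans (m≤m+n 9 2) (+-monoˡ-≤ 1 (+-monoˡ-≤ 5 (*-monoʳ-≤ 5 {1} {2 + i} (s≤s z≤n))))
  top-leaf top    (top-wrap _) = m≤m+n 9 2
  top-leaf {R = R} bottom _    = +-monoˡ-≤ 3 (m≤n+m 6 (5 * R))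

  leaf-bottom : ∀ {y i R c} → Offset y c → Round y i R → 5 * R + c + 5 ≤ 5 * n + 7 + (∣ 0 - y ∣ + 1)
  leaf-bottom {R = R} hub r = linear (*-monoʳ-≤ 5 (round≤ r)) 1 (eq (5 * R) (5 * n))
    where
    eq : ∀ R n → R + 3 + 5 + n + 1 ≡ n + 7 + 2 + R
    eq = solve-∀
  leaf-bottom {R = R} top r = linear (*-monoʳ-≤ 5 (round≤ r)) 0 (eq (5 * R) (5 * n))
    where
    eq : ∀ R n → R + 5 + 5 + n + 0 ≡ n + 7 + 3 + R
    eq = solve-∀
  leaf-bottom {R = R} bottom r = linear (*-monoʳ-≤ 5 (bottom-round< r)) 2 (eq R (5 * n))
    where
    eq : ∀ R n → 5 * R + 6 + 5 + n + 2 ≡ n + 7 + 1 + 5 * suc R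
    eq = solve-∀

  22≤end : 22 ≤ 5 * n + 7
  22≤end = ≤-trans (m≤m+n 22 5) (+-monoˡ-≤ 7 (*-monoʳ-≤ 5 4≤n))

  apart : ∀ {y y′ a b v w} → At y a v → At y′ b w → (y ≡ y′ → a ≢ b) → Apart₅ (∣ y - y′ ∣ + starDist a b) v w
  apart hub        hub          ne = ⊥-elim (ne refl refl)
  apart hub        top          ne = inj₁ ≤-refl
  apart hub        bottom       ne = inj₁ (≤-trans (≤-trans (m≤m+n 5 17) 22≤end) (m≤m+n _ 1))
  apart hub        (leaf {y} o r) ne = inj₁ (hub-leaf (∣ 1 - y ∣ + 1) o r)
  apart top        hub          ne = inj₂ ≤-refl
  apart top        top          ne = ⊥-elim (ne refl refl)
  apart top        bottom       ne = inj₁ (≤-trans (≤-trans (m≤m+n 9 13) 22≤end) (m≤m+n _ 2))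
  apart top        (leaf o r)   ne = inj₁ (top-leaf o r)
  apart bottom     hub          ne = inj₂ (≤-trans (≤-trans (m≤m+n 5 17) 22≤end) (m≤m+n _ 1))
  apart bottom     top          ne = inj₂ (≤-trans (≤-trans (m≤m+n 9 13) 22≤end) (m≤m+n _ 2))
  apart bottom     bottom       ne = ⊥-elim (ne refl refl)
  apart bottom     (leaf o r)   ne = inj₂ (leaf-bottom o r)
  apart (leaf {y} o r) hub      ne = inj₂ (hub-leaf (∣ y - 1 ∣ + 1) o r)
  apart (leaf {y} {R = R} {c} o r) top ne = inj₂ (subst (λ d → 9 ≤ 5 * R + c + (d + 1)) (∣-∣-comm 2 y) (top-leaf o r))
  apart (leaf {y} {R = R} {c} o r) bottom ne = inj₁ (subst (λ d → 5 * R + c + 5 ≤ 5 * n + 7 + (d + 1)) (∣-∣-comm 0 y) (leaf-bottom o r))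
  apart (leaf {y} {i} o r) (leaf {y′} {i′} o′ r′) ne = by-leaf i i′
    (λ { refl → same-leaf _ o r o′ r′ (λ eq → ne eq refl) })
    (λ i≢i′ → subst (λ s → Apart₅ (∣ y - y′ ∣ + s) _ _) (sym (starDist-leaves i≢i′)) (distinct-leaves o r o′ r′ i≢i′))

  value : ∀ y a → y < 3 → a ≤ n → ∃ (At y a)
  value 0 zero          _ _   = _ , bottom
  value 0 (suc zero)    _ a≤n = _ , leaf bottom (bottom-wrap (m+[n∸m]≡n (≤-trans (s≤s z≤n) 4≤n)))
  value 0 (suc (suc i)) _ a≤n = _ , leaf bottom (bottom a≤n)
  value 1 zero          _ _   = _ , hub
  value 1 (suc i)       _ a≤n = _ , leaf hub (hub a≤n)
  value 2 zero          _ _   = _ , top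
  value 2 (suc i)       _ a≤n with m≤n⇒m<n∨m≡n a≤n
  ... | inj₁ lt = _ , leaf top (top lt)
  ... | inj₂ eq = _ , leaf top (top-wrap eq)
  value (suc (suc (suc y))) a (s≤s (s≤s (s≤s ()))) _

  value≤ : ∀ {y a v} → At y a v → v ≤ 5 * n + 7
  value≤ hub        = z≤n
  value≤ top        = ≤-trans (m≤m+n 4 18) 22≤end
  value≤ bottom     = ≤-refl
  value≤ (leaf o r) = +-mono-≤ (*-monoʳ-≤ 5 (round≤ r)) (≤-trans (proj₂ (Offset-bounds o)) (n≤1+n 6))

  open Product 3 n

  vertex-value : ∀ (u : V G) → ∃ (At (toℕ (proj₁ u)) (toℕ (proj₂ u)))
  vertex-value (i , a) = value (toℕ i) (toℕ a) (toℕ<n i) (toℕ≤pred[n] a)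

  labeling : V G → ℕ
  labeling u = proj₁ (vertex-value u)

  separated : ∀ u v → u ≢ v → 5 ≤ ∣ labeling u - labeling v ∣ + dist u v
  separated u@(i , a) v@(j , b) u≢v with vertex-value u | vertex-value v
  ... | f , p | g , q with apart p q (λ i≡j a≡b → u≢v (cong₂ _,_ (toℕ-injective i≡j) (toℕ-injective a≡b)))
  ...   | inj₁ le = gap⇒∣-∣ f g le
  ...   | inj₂ le = subst (λ d → 5 ≤ d + dist u v) (∣-∣-comm g f) (gap⇒∣-∣ g f le)

theorem-three-large : ∀ n → 4 ≤ n → IsRadioNumber (P 3 □ K1 n) ⌊ (3 * 3 * (n + 1) + 2 * 3 + n ∸ 1) /2⌋
theorem-three-large n@(suc n₀) 4≤n = radioNumber 3 n ≤-refl (≤-trans (n≤1+n 3) 4≤n)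
  labeling (Fin.suc Fin.zero , Fin.zero) (Fin.zero , Fin.zero) separated (λ w → z≤n , value≤ (proj₂ (vertex-value w)))
  ⌊ (3 * 3 * (n + 1) + 2 * 3 + n ∸ 1) /2⌋ (sym r≡) (trans (cong (λ r → r + totalWeight 3 n + 5) r≡) (tight n))
  where
  open Three n 4≤n
  double : ∀ n → 3 * 3 * (suc n + 1) + 2 * 3 + n ≡ 5 * suc n + 7 + (5 * suc n + 7)
  double = solve-∀
  r≡ : ⌊ (3 * 3 * (n + 1) + 2 * 3 + n ∸ 1) /2⌋ ≡ 5 * n + 7
  r≡ = trans (cong ⌊_/2⌋ (trans (cong (_∸ 1) (+-suc (3 * 3 * (n + 1) + 2 * 3) n₀)) (double n₀))) (sym (n≡⌊n+n/2⌋ (5 * n + 7)))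
  tight : ∀ n → 5 * n + 7 + (suc n * 4 + 3 * (2 * n)) + 5 ≡ 5 * (3 * suc n) + 1
  tight = solve-∀

-- The case m = n = 3

module ThreeThree where

  open Product 3 3

  -- With only three leaves the scheme of `Three` breaks down; this labeling was found by search.
  table : Vec (Vec ℕ 4) 3
  table = (14 ∷ 3 ∷ 8 ∷ 20 ∷ []) ∷ (0 ∷ 10 ∷ 18 ∷ 6 ∷ []) ∷ (22 ∷ 16 ∷ 4 ∷ 12 ∷ []) ∷ []

  labeling : V G → ℕ
  labeling (i , a) = lookup (lookup table i) a

  separated : ∀ u v → u ≢ v → 5 ≤ ∣ labeling u - labeling v ∣ + dist u v
  separated (i , a) (j , b) u≢v with check i a j b
    where
    check : ∀ i a j b → (i ≡ j × a ≡ b) ⊎ 5 ≤ ∣ labeling (i , a) - labeling (j , b) ∣ + dist (i , a) (j , b)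
    check = toWitness {a? = Fin.all? λ i → Fin.all? λ a → Fin.all? λ j → Fin.all? λ b →
      (i Fin.≟ j ×-dec a Fin.≟ b) ⊎-dec (5 ≤? ∣ labeling (i , a) - labeling (j , b) ∣ + dist (i , a) (j , b))} _
  ... | inj₁ (refl , refl) = ⊥-elim (u≢v refl)
  ... | inj₂ le            = le

  ≤22 : ∀ i a → labeling (i , a) ≤ 22
  ≤22 = toWitness {a? = Fin.all? λ i → Fin.all? λ a → labeling (i , a) ≤? 22} _

-- The odd formula computes to 22 here. The ends are the centre vertices of rows 1 and 2, adjacent
-- and of weights 0 and 2.
theorem-three-three : IsRadioNumber (P 3 □ K1 3) 22
theorem-three-three = radioNumber 3 3 ≤-refl ≤-refl labeling
  (Fin.suc Fin.zero , Fin.zero) (Fin.suc (Fin.suc Fin.zero) , Fin.zero) separated (λ { (i , a) → z≤n , ≤22 i a }) 22 refl refl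
  where open ThreeThree

theorem-three : ∀ n → 3 ≤ n → IsRadioNumber (P 3 □ K1 n) ⌊ (3 * 3 * (n + 1) + 2 * 3 + n ∸ 1) /2⌋
theorem-three n 3≤n with m≤n⇒m<n∨m≡n 3≤n
... | inj₁ 4≤n  = theorem-three-large n 4≤n
... | inj₂ refl = theorem-three-three

-- Assembly by the parity of m

odd-path : ∀ q n → 3 ≤ suc (q + q) → 3 ≤ n → IsRadioNumber (P (suc (q + q)) □ K1 n)
  ⌊ (suc (q + q) * suc (q + q) * (n + 1) + 2 * suc (q + q) + n ∸ 1) /2⌋
odd-path 0             n (s≤s ()) 3≤n
odd-path 1             n _ 3≤n = theorem-three n 3≤n
odd-path (suc (suc q)) n _ 3≤n = theorem-odd (2 + q) n (s≤s (s≤s z≤n)) 3≤n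

even-path : ∀ q n → 3 ≤ q + q → 3 ≤ n → IsRadioNumber (P (q + q) □ K1 n)
  ⌊ ((q + q) * (q + q) * (n + 1) + 2 * (q + q ∸ 1)) /2⌋
even-path 1             n (s≤s (s≤s ())) 3≤n
even-path (suc (suc q)) n _ 3≤n = theorem-even (2 + q) n (s≤s (s≤s z≤n)) 3≤n

halves : ∀ m {r} → m % 2 ≡ r → m ≡ r + (m / 2 + m / 2)
halves m refl = trans (m≡m%n+[m/n]*n m 2) (cong (m % 2 +_) (double (m / 2)))
  where
  double : ∀ q → q * 2 ≡ q + q
  double = solve-∀

theorem4p2 : (m n : ℕ) → 3 ≤ m → 3 ≤ n →
    ((m % 2 ≡ 1 → IsRadioNumber (P m □ K1 n) ⌊ (m * m * (n + 1) + 2 * m + n ∸ 1) /2⌋)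
    × (m % 2 ≡ 0 → IsRadioNumber (P m □ K1 n) ⌊ (m * m * (n + 1) + 2 * (m ∸ 1)) /2⌋))
theorem4p2 m n 3≤m 3≤n = odd , even
  where
  odd : m % 2 ≡ 1 → IsRadioNumber (P m □ K1 n) ⌊ (m * m * (n + 1) + 2 * m + n ∸ 1) /2⌋
  odd eq = subst (λ m → IsRadioNumber (P m □ K1 n) ⌊ (m * m * (n + 1) + 2 * m + n ∸ 1) /2⌋) (sym (halves m eq))
    (odd-path (m / 2) n (subst (3 ≤_) (halves m eq) 3≤m) 3≤n)
  even : m % 2 ≡ 0 → IsRadioNumber (P m □ K1 n) ⌊ (m * m * (n + 1) + 2 * (m ∸ 1)) /2⌋
  even eq = subst (λ m → IsRadioNumber (P m □ K1 n) ⌊ (m * m * (n + 1) + 2 * (m ∸ 1)) /2⌋) (sym (halves m eq))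
    (even-path (m / 2) n (subst (3 ≤_) (halves m eq) 3≤m) 3≤n)
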